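{- Each of the permutations $215463$, $236145$ and $214653$ is an annihilator: for each $\phi\in\{215463,236145,214653\}$, every permutation $\pi$ that has an interval copy of $\phi$ satisfies $\mu[1,\pi]=0$.
   Context: Permutations are ordered by containment: $\sigma\le\pi$ if $\pi$ has a subsequence order-isomorphic to $\sigma$. The Möbius function: $\mu[\sigma,\pi]=0$ if $\sigma\not\le\pi$, $\mu[\sigma,\pi]=1$ if $\sigma=\pi$, and $\mu[\sigma,\pi]=-\sum_{\sigma\le\tau<\pi}\mu[\sigma,\tau]$ otherwise; $1$ is the permutation of length one. An interval of a permutation is a non-empty set of contiguous positions whose values form a set of consecutive integers; $\pi$ has an interval copy of $\phi$ if it has an interval of length $|\phi|$ whose entries are order-isomorphic to $\phi$. -}

module Defs where

open import Data.Nat using (ℕ; zero; suc; _+_; _∸_; _≤_; _<_; _<ᵇ_; _≡ᵇ_)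
open import Data.Bool using (Bool; true; false; _∧_; if_then_else_; T)
open import Data.List using (List; []; _∷_; length; map; concatMap; zip; take; drop; upTo; _++_)
open import Data.Bool.ListAction using (any)
open import Data.List.Relation.Binary.Permutation.Propositional using (_↭_)
open import Data.List.Relation.Unary.All using (All)
open import Data.Product using (_×_; _,_; ∃)
open import Data.Integer using (ℤ; -_) renaming (_+_ to _+ℤ_)
import Data.Integer as ℤ
open import Relation.Binary.PropositionalEquality using (_≡_)

-- Permutations of length n are lists of naturals that are a rearrangement
-- of 0,1,…,n-1 (one-line notation, 0-based).
IsPerm : List ℕ → Set
IsPerm π = π ↭ upTo (length π)

eqL : List ℕ → List ℕ → Bool
eqL []       []       = true
eqL (x ∷ xs) (y ∷ ys) = (x ≡ᵇ y) ∧ eqL xs ys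
eqL _        _        = false

_⇔ᵇ_ : Bool → Bool → Bool
true  ⇔ᵇ b = b
false ⇔ᵇ true  = false
false ⇔ᵇ false = true

allᵇ : {A : Set} → (A → Bool) → List A → Bool
allᵇ p []       = true
allᵇ p (x ∷ xs) = p x ∧ allᵇ p xs

orderIso : List ℕ → List ℕ → Bool
orderIso xs ys =
  (length xs ≡ᵇ length ys) ∧
  allᵇ (λ { (a , b) → allᵇ (λ { (c , d) → (a <ᵇ c) ⇔ᵇ (b <ᵇ d) }) ps }) ps
  where ps = zip xs ys

subseqs : List ℕ → List (List ℕ)
subseqs []       = [] ∷ []
subseqs (x ∷ xs) = let r = subseqs xs in map (x ∷_) r ++ r

contains : List ℕ → List ℕ → Bool
contains σ π = any (orderIso σ) (subseqs π)

insertions : ℕ → List ℕ → List (List ℕ)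
insertions n []       = (n ∷ []) ∷ []
insertions n (x ∷ xs) = (n ∷ x ∷ xs) ∷ map (x ∷_) (insertions n xs)

perms : ℕ → List (List ℕ)
perms zero    = [] ∷ []
perms (suc k) = concatMap (insertions k) (perms k)

sumℤ : List ℤ → ℤ
sumℤ []       = ℤ.0ℤ
sumℤ (x ∷ xs) = x +ℤ sumℤ xs

properLengths : ℕ → List ℕ
properLengths n = map suc (upTo (n ∸ 1))

-- μ[1,π] with fuel: μ[1,1] = 1; otherwise
-- μ[1,π] = - Σ_{1 ≤ τ < π} μ[1,τ], where τ ranges over the permutations of
-- lengths 1..|π|-1 contained in π (every nonempty permutation contains 1,
-- and τ < π for a permutation π forces |τ| < |π|).
mu1F : ℕ → List ℕ → ℤ
mu1F zero    π = ℤ.0ℤ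
mu1F (suc f) π =
  if eqL π (0 ∷ [])
  then ℤ.1ℤ
  else - sumℤ (concatMap
         (λ k → concatMap (λ τ → if contains τ π then mu1F f τ ∷ [] else [])
                          (perms k))
         (properLengths (length π)))

-- The Möbius function μ[1,π] (for π a permutation; 0 for the empty one,
-- which does not contain 1).
mu1 : List ℕ → ℤ
mu1 π = mu1F (length π) π

HasIntervalCopy : List ℕ → List ℕ → Set
HasIntervalCopy φ π =
  ∃ λ i → let seg = take (length φ) (drop i π) in
    length seg ≡ length φ ×
    (∃ λ a → All (λ x → a ≤ x × x < a + length φ) seg) ×
    T (orderIso φ seg)

Annihilator : List ℕ → Set
Annihilator φ = (π : List ℕ) → IsPerm π → HasIntervalCopy φ π → mu1 π ≡ ℤ.0ℤ

{-# OPTIONS --safe #-}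

-- Call a pair (α , β) annihilating if μ[1,π] = 0 whenever π has disjoint interval copies of α and β;
-- β may be empty.  Finitely many such pairs, among them the three permutations of the theorem, are
-- shown to be annihilating by one simultaneous induction on |π|.  For sublists t of α and u of β, let
-- π[t,u] be π with the two copies cut down to t and u.  For each pair there are signs ε(t,u) with
--   [λ ≤ π] = Σ ε(t,u) [λ ≤ π[t,u]]
-- for every λ < π with μ[1,λ] ≠ 0; since Σ_{λ ≤ ρ} μ[1,λ] = 0 as soon as |ρ| ≥ 2, multiplying by μ[1,λ]
-- and summing over λ < π gives μ[1,π] = 0.
-- For the identity, each embedding of λ into π meets the two copies in patterns a ≤ α and b ≤ β, and
-- λ ≤ π[t,u] iff some embedding has a ≤ t and b ≤ u.  The blocks of a and b that are intervals are
-- intervals of λ.  So, by induction, the patterns of the embeddings of λ jointly exhibit no annihilating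
-- pair, since for the pairs used here two copies in λ cannot overlap.  This leaves finitely many possible
-- sets of patterns (a , b), and the identity is evaluated on each of them.
module Submission where

open import Defs
open import Data.Nat using
  (ℕ; zero; suc; pred; _+_; _≤_; _<_; _<ᵇ_; _≤ᵇ_; _≡ᵇ_; _/_; _%_; z≤n; s≤s; _≤′_; ≤′-refl; ≤′-step)
open import Data.Nat.Properties using
  (+-identityʳ; +-monoʳ-<; +-suc; 1+n≰n; <-asym; <-cmp; <-trans; <-≤-trans; <ᵇ⇒<; <⇒<ᵇ; <⇒≱; _<?_;
   m<n⇒m<1+n; m≤m+n; m≤n+m; m≤n⇒m≤1+n; m≤n⇒m⊓n≡m; n<1+n; n≮n; suc-injective; ≡ᵇ⇒≡; ≡⇒≡ᵇ; ≤-pred;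
   ≤-refl; ≤-reflexive; ≤-trans; ≤ᵇ⇒≤; ≤′⇒≤; ≤⇒≤′; ≮⇒≥)
open import Data.Nat.Tactic.RingSolver using (solve-∀)
open import Data.Bool using (Bool; true; false; _∧_; _∨_; not; if_then_else_; T)
open import Data.Bool.ListAction using (any; all)
open import Data.Bool.Properties using (T-∧; T-∨; T-≡; T?)
open import Data.Empty using (⊥-elim)
open import Data.Integer as ℤ using (ℤ; 0ℤ; 1ℤ; -_) renaming (_+_ to _+ℤ_; _*_ to _*ℤ_)
import Data.Integer.Properties as ℤ
import Data.Integer.Tactic.RingSolver as ℤSolver
open import Data.List using
  (List; []; _∷_; [_]; length; map; concatMap; zip; zipWith; take; drop; upTo; _++_; null; filterᵇ)
open import Data.List.Properties using
  (++-assoc; ++-identityʳ; length-++; length-take; map-++; map-∘; concatMap-++; take++drop≡id; upTo-∷ʳ)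
open import Data.List.Membership.Propositional using (_∈_; find; lose)
open import Data.List.Membership.Propositional.Properties using
  (∈-map⁺; ∈-map⁻; ∈-++⁺ˡ; ∈-++⁺ʳ; ∈-++⁻; ∈-concatMap⁺; ∈-filter⁺)
import Data.List.Relation.Binary.Permutation.Propositional as ↭
import Data.List.Relation.Binary.Permutation.Setoid.Properties as ↭ₛ
open import Data.List.Relation.Binary.Pointwise as Pointwise using (Pointwise; []; _∷_)
open import Data.List.Relation.Binary.Sublist.Propositional using (_⊆_; []; _∷_; _∷ʳ_; ⊆-refl; ⊆-trans; from∈)
open import Data.List.Relation.Binary.Sublist.Propositional.Properties using
  (length-mono-≤; All-resp-⊆; ++⁺; ++⁺ˡ; ++⁺ʳ)
open import Data.List.Relation.Unary.All as All using (All; []; _∷_)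
import Data.List.Relation.Unary.All.Properties as All
open import Data.List.Relation.Unary.AllPairs using ([]; _∷_)
open import Data.List.Relation.Unary.Any using (here; there)
open import Data.List.Relation.Unary.Any.Properties using (any⁺; any⁻)
open import Data.List.Relation.Unary.Unique.Propositional using (Unique)
import Data.List.Relation.Unary.Unique.Propositional.Properties as Unique
open import Data.Product using (_×_; _,_; ∃; ∃₂; proj₁; proj₂; swap; uncurry)
open import Data.Sum as Sum using (_⊎_; inj₁; inj₂; [_,_]′)
open import Data.Unit using (⊤; tt)
open import Function using (_∘_; Equivalence)
open import Relation.Binary.Definitions using (tri<; tri≈; tri>)
open import Relation.Binary.PropositionalEquality using
  (_≡_; _≢_; refl; sym; trans; cong; cong₂; subst; subst₂; setoid; module ≡-Reasoning)
open import Relation.Nullary using (¬_; yes; no; contradiction)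
open import Relation.Nullary.Decidable using (decidable-stable)
open Equivalence using (to; from)

-- Order isomorphism

private variable
  X Y : Set

-- Both directions are recorded because `≅` visits each pair of positions once, whereas `orderIso`
-- runs through all ordered pairs.
Same : ℕ → ℕ → ℕ → ℕ → Set
Same x y c d = (x <ᵇ c) ≡ (y <ᵇ d) × (c <ᵇ x) ≡ (d <ᵇ y)

-- The comparisons between the two parts of a concatenation, which `us ≅ vs` and `rs ≅ ss` leave
-- open.
Cross : List ℕ → List ℕ → List ℕ → List ℕ → Set
Cross us vs rs ss = Pointwise (λ x y → Pointwise (Same x y) rs ss) us vs

infix 4 _≅_
data _≅_ : List ℕ → List ℕ → Set where
  []  : [] ≅ []
  _∷_ : ∀ {x y xs ys} → Pointwise (Same x y) xs ys → xs ≅ ys → x ∷ xs ≅ y ∷ ys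

Same-refl : ∀ x c → Same x x c c
Same-refl x c = refl , refl

≅-refl : ∀ {xs} → xs ≅ xs
≅-refl {[]}     = []
≅-refl {x ∷ xs} = Pointwise.refl (Same-refl x _) ∷ ≅-refl

≅-sym : ∀ {xs ys} → xs ≅ ys → ys ≅ xs
≅-sym []       = []
≅-sym (p ∷ ps) = Pointwise.symmetric (λ (p , q) → sym p , sym q) p ∷ ≅-sym ps

≅-trans : ∀ {xs ys zs} → xs ≅ ys → ys ≅ zs → xs ≅ zs
≅-trans []       []       = []
≅-trans (p ∷ ps) (q ∷ qs) =
  Pointwise.transitive (λ (a , b) (c , d) → trans a c , trans b d) p q ∷ ≅-trans ps qs

≅-length : ∀ {xs ys} → xs ≅ ys → length xs ≡ length ys
≅-length []       = refl
≅-length (_ ∷ ps) = cong suc (≅-length ps)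

Cross-swap : ∀ {us vs rs ss} → length rs ≡ length ss → Cross us vs rs ss → Cross rs ss us vs
Cross-swap {rs = []}    {[]}    _ _ = []
Cross-swap {rs = _ ∷ _} {_ ∷ _} e cs =
  Pointwise.map (λ { (p ∷ _) → swap p }) cs
  ∷ Cross-swap (cong pred e) (Pointwise.map (λ { (_ ∷ ps) → ps }) cs)

≅-++⁺ : ∀ {us vs rs ss} → us ≅ vs → rs ≅ ss → Cross us vs rs ss → us ++ rs ≅ vs ++ ss
≅-++⁺ []       rs []       = rs
≅-++⁺ (p ∷ ps) rs (c ∷ cs) = Pointwise.++⁺ p c ∷ ≅-++⁺ ps rs cs

Pointwise-++⁻ : ∀ {R : ℕ → ℕ → Set} us {rs vs ss} → length us ≡ length vs →
                Pointwise R (us ++ rs) (vs ++ ss) → Pointwise R us vs × Pointwise R rs ss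
Pointwise-++⁻ []       {vs = []}     _ ps       = [] , ps
Pointwise-++⁻ (_ ∷ us) {vs = _ ∷ vs} e (p ∷ ps) =
  let ps₁ , ps₂ = Pointwise-++⁻ us (cong pred e) ps in p ∷ ps₁ , ps₂

≅-++⁻ : ∀ us {rs ws} → us ++ rs ≅ ws →
        ∃₂ λ vs ss → ws ≡ vs ++ ss × us ≅ vs × rs ≅ ss × Cross us vs rs ss
≅-++⁻ []       ps = [] , _ , refl , [] , ps , []
≅-++⁻ (u ∷ us) (p ∷ ps) with ≅-++⁻ us ps
... | vs , ss , refl , q , r , c =
  let p₁ , p₂ = Pointwise-++⁻ us (≅-length q) p in
  _ ∷ vs , ss , refl , p₁ ∷ q , r , p₂ ∷ c

allᵇ⁻ : (p : X → Bool) → ∀ xs → T (allᵇ p xs) → All (T ∘ p) xs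
allᵇ⁻ p []       _ = []
allᵇ⁻ p (x ∷ xs) h = let px , pxs = to T-∧ h in px ∷ allᵇ⁻ p xs pxs

allᵇ⁺ : (p : X → Bool) → ∀ {xs} → All (T ∘ p) xs → T (allᵇ p xs)
allᵇ⁺ p []         = tt
allᵇ⁺ p (px ∷ pxs) = from T-∧ (px , allᵇ⁺ p pxs)

⇔ᵇ⇒≡ : ∀ a {b} → T (a ⇔ᵇ b) → a ≡ b
⇔ᵇ⇒≡ true  {true}  _ = refl
⇔ᵇ⇒≡ false {false} _ = refl

≡⇒⇔ᵇ : ∀ a {b} → a ≡ b → T (a ⇔ᵇ b)
≡⇒⇔ᵇ true  refl = tt
≡⇒⇔ᵇ false refl = tt

Agree : ℕ × ℕ → ℕ × ℕ → Set
Agree (a , b) (c , d) = (a <ᵇ c) ≡ (b <ᵇ d)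

agree⇒≅ : ∀ xs ys → length xs ≡ length ys →
          All (λ p → All (Agree p) (zip xs ys)) (zip xs ys) → xs ≅ ys
agree⇒≅ []       []       _ _ = []
agree⇒≅ (x ∷ xs) (y ∷ ys) e ((_ ∷ ps) ∷ pss) =
  heads xs ys (cong pred e) ps (All.map All.head pss)
  ∷ agree⇒≅ xs ys (cong pred e) (All.map All.tail pss)
  where
  heads : ∀ xs ys → length xs ≡ length ys → All (Agree (x , y)) (zip xs ys) →
          All (λ p → Agree p (x , y)) (zip xs ys) → Pointwise (Same x y) xs ys
  heads []       []       _ _        _        = []
  heads (_ ∷ xs) (_ ∷ ys) e (p ∷ ps) (q ∷ qs) = (p , q) ∷ heads xs ys (cong pred e) ps qs

Pointwise⇒zip : ∀ {P : ℕ × ℕ → Set} {xs ys} → Pointwise (λ x y → P (x , y)) xs ys → All P (zip xs ys)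
Pointwise⇒zip []       = []
Pointwise⇒zip (p ∷ ps) = p ∷ Pointwise⇒zip ps

≅⇒agree : ∀ {xs ys} → xs ≅ ys → All (λ p → All (Agree p) (zip xs ys)) (zip xs ys)
≅⇒agree []               = []
≅⇒agree {x ∷ _} {y ∷ _} (p ∷ ps) =
  (trans (<ᵇ-irrefl x) (sym (<ᵇ-irrefl y)) ∷ Pointwise⇒zip (Pointwise.map proj₁ p))
  ∷ All.zipWith (uncurry _∷_) (Pointwise⇒zip (Pointwise.map proj₂ p) , ≅⇒agree ps)
  where
  <ᵇ-irrefl : ∀ x → (x <ᵇ x) ≡ false
  <ᵇ-irrefl zero    = refl
  <ᵇ-irrefl (suc x) = <ᵇ-irrefl x

orderIso⇒≅ : ∀ xs ys → T (orderIso xs ys) → xs ≅ ys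
orderIso⇒≅ xs ys h =
  let e , ps = to T-∧ h in
  agree⇒≅ xs ys (≡ᵇ⇒≡ _ _ e)
    (All.map (λ { {a , b} q → All.map (λ { {c , d} → ⇔ᵇ⇒≡ (a <ᵇ c) }) (allᵇ⁻ _ (zip xs ys) q) })
      (allᵇ⁻ _ (zip xs ys) ps))

≅⇒orderIso : ∀ {xs ys} → xs ≅ ys → T (orderIso xs ys)
≅⇒orderIso ps = from T-∧
  ( ≡⇒≡ᵇ _ _ (≅-length ps)
  , allᵇ⁺ _ (All.map (λ { {a , b} q → allᵇ⁺ _ (All.map (λ { {c , d} → ≡⇒⇔ᵇ (a <ᵇ c) }) q) }) (≅⇒agree ps)))

-- Containment

subseqs⁺ : ∀ {w π} → w ⊆ π → w ∈ subseqs π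
subseqs⁺ []         = here refl
subseqs⁺ {π = _ ∷ π} (y ∷ʳ p) = ∈-++⁺ʳ (map (y ∷_) (subseqs π)) (subseqs⁺ p)
subseqs⁺ (refl ∷ p) = ∈-++⁺ˡ (∈-map⁺ (_ ∷_) (subseqs⁺ p))

subseqs⁻ : ∀ π {w} → w ∈ subseqs π → w ⊆ π
subseqs⁻ []      (here refl) = []
subseqs⁻ (x ∷ π) h with ∈-++⁻ (map (x ∷_) (subseqs π)) h
... | inj₂ q = x ∷ʳ subseqs⁻ π q
... | inj₁ q with ∈-map⁻ (x ∷_) q
...   | _ , r , refl = refl ∷ subseqs⁻ π r

infix 4 _≼_
_≼_ : List ℕ → List ℕ → Set
σ ≼ π = ∃ λ w → w ⊆ π × σ ≅ w

contains⇒≼ : ∀ σ π → T (contains σ π) → σ ≼ π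
contains⇒≼ σ π h with find (any⁻ (orderIso σ) (subseqs π) h)
... | w , p , q = w , subseqs⁻ π p , orderIso⇒≅ σ w q

≼⇒contains : ∀ {σ π} → σ ≼ π → T (contains σ π)
≼⇒contains {σ} (w , p , q) = any⁺ (orderIso σ) (lose (subseqs⁺ p) (≅⇒orderIso q))

-- The relation `R` is general so that, when a head is kept, its comparisons with the tail can be
-- carried down the recursion to the chosen sublist.
⊆-Pointwise-≅ : ∀ {R : ℕ → ℕ → Set} {s xs ys} → s ⊆ xs → xs ≅ ys → Pointwise R xs ys →
                ∃ λ t → t ⊆ ys × s ≅ t × Pointwise R s t
⊆-Pointwise-≅ []         []       []       = [] , [] , [] , []
⊆-Pointwise-≅ (_ ∷ʳ p)   (_ ∷ qs) (_ ∷ rs) =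
  let t , a , e , c = ⊆-Pointwise-≅ p qs rs in t , _ ∷ʳ a , e , c
⊆-Pointwise-≅ (refl ∷ p) (q ∷ qs) (r ∷ rs) =
  let t , a , e , c = ⊆-Pointwise-≅ p qs (both q rs)
  in  _ ∷ t , refl ∷ a , Pointwise.map proj₁ c ∷ e , r ∷ Pointwise.map proj₂ c
  where
  both : ∀ {P Q : ℕ → ℕ → Set} {xs ys} → Pointwise P xs ys → Pointwise Q xs ys →
         Pointwise (λ x y → P x y × Q x y) xs ys
  both []       []       = []
  both (p ∷ ps) (q ∷ qs) = (p , q) ∷ both ps qs

⊆-≅ : ∀ {s xs ys} → s ⊆ xs → xs ≅ ys → ∃ λ t → t ⊆ ys × s ≅ t
⊆-≅ p q = let t , r , e , _ = ⊆-Pointwise-≅ p q (≅⇒Pointwise q) in t , r , e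
  where
  ≅⇒Pointwise : ∀ {xs ys} → xs ≅ ys → Pointwise (λ _ _ → ⊤) xs ys
  ≅⇒Pointwise []       = []
  ≅⇒Pointwise (_ ∷ ps) = tt ∷ ≅⇒Pointwise ps

≅⇒≼ : ∀ {σ τ} → σ ≅ τ → σ ≼ τ
≅⇒≼ e = _ , ⊆-refl , e

≼-trans : ∀ {ρ σ τ} → ρ ≼ σ → σ ≼ τ → ρ ≼ τ
≼-trans (v , p , e) (w , q , f) = let t , r , g = ⊆-≅ p f in t , ⊆-trans r q , ≅-trans e g

≼-⊆ : ∀ {ρ σ τ} → ρ ≼ σ → σ ⊆ τ → ρ ≼ τ
≼-⊆ (v , p , e) q = v , ⊆-trans p q , e

≼-length : ∀ {σ π} → σ ≼ π → length σ ≤ length π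
≼-length (w , p , e) = ≤-trans (≤-reflexive (≅-length e)) (length-mono-≤ p)

⊆-length-≡ : ∀ {s xs : List ℕ} → s ⊆ xs → length xs ≤ length s → s ≡ xs
⊆-length-≡ []         _                  = refl
⊆-length-≡ (_ ∷ʳ p)   h                  = ⊥-elim (1+n≰n (≤-trans h (length-mono-≤ p)))
⊆-length-≡ (refl ∷ p) (s≤s h) = cong (_ ∷_) (⊆-length-≡ p h)

Unique-⊆ : ∀ {s xs : List ℕ} → s ⊆ xs → Unique xs → Unique s
Unique-⊆ []         []       = []
Unique-⊆ (_ ∷ʳ p)   (_ ∷ us) = Unique-⊆ p us
Unique-⊆ (refl ∷ p) (u ∷ us) = All-resp-⊆ p u ∷ Unique-⊆ p us

Same-≢ : ∀ {x y c d} → Same x y c d → y ≢ d → x ≢ c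
Same-≢ {x} {y} {d = d} (p , q) y≢d refl with <-cmp y d
... | tri< lt _ _ = ⊥-elim (n≮n x (<ᵇ⇒< x x (subst T (sym p) (<⇒<ᵇ lt))))
... | tri≈ _ e _  = ⊥-elim (y≢d e)
... | tri> _ _ lt = ⊥-elim (n≮n x (<ᵇ⇒< x x (subst T (sym q) (<⇒<ᵇ lt))))

Unique-≅ : ∀ {xs ys} → xs ≅ ys → Unique ys → Unique xs
Unique-≅ []       []       = []
Unique-≅ (p ∷ ps) (u ∷ us) = go p u ∷ Unique-≅ ps us
  where
  go : ∀ {x y xs ys} → Pointwise (Same x y) xs ys → All (y ≢_) ys → All (x ≢_) xs
  go []       []       = []
  go (p ∷ ps) (u ∷ us) = Same-≢ p u ∷ go ps us

T-injective : ∀ {a b} → (T a → T b) → (T b → T a) → a ≡ b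
T-injective {true}  {true}  _ _ = refl
T-injective {false} {false} _ _ = refl
T-injective {true}  {false} f _ = ⊥-elim (f _)
T-injective {false} {true}  _ g = ⊥-elim (g _)

contains-congʳ : ∀ {σ ρ} → σ ≅ ρ → ∀ τ → contains τ ρ ≡ contains τ σ
contains-congʳ e τ = T-injective
  (λ h → ≼⇒contains (≼-trans (contains⇒≼ τ _ h) (≅⇒≼ (≅-sym e))))
  (λ h → ≼⇒contains (≼-trans (contains⇒≼ τ _ h) (≅⇒≼ e)))

-- Sums over permutations

sumOver : (X → ℤ) → List X → ℤ
sumOver f xs = sumℤ (map f xs)

sumℤ-++ : ∀ xs ys → sumℤ (xs ++ ys) ≡ sumℤ xs +ℤ sumℤ ys
sumℤ-++ []       ys = sym (ℤ.+-identityˡ _)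
sumℤ-++ (x ∷ xs) ys = trans (cong (x +ℤ_) (sumℤ-++ xs ys)) (sym (ℤ.+-assoc x _ _))

sumOver-++ : (f : X → ℤ) → ∀ xs ys → sumOver f (xs ++ ys) ≡ sumOver f xs +ℤ sumOver f ys
sumOver-++ f xs ys = trans (cong sumℤ (map-++ f xs ys)) (sumℤ-++ (map f xs) _)

sumOver-concatMap : (f : Y → ℤ) (g : X → List Y) → ∀ xs →
                    sumOver f (concatMap g xs) ≡ sumOver (sumOver f ∘ g) xs
sumOver-concatMap f g []       = refl
sumOver-concatMap f g (x ∷ xs) =
  trans (sumOver-++ f (g x) _) (cong (sumOver f (g x) +ℤ_) (sumOver-concatMap f g xs))

sumOver-cong : {f g : X → ℤ} → ∀ {xs} → All (λ x → f x ≡ g x) xs → sumOver f xs ≡ sumOver g xs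
sumOver-cong []       = refl
sumOver-cong (p ∷ ps) = cong₂ _+ℤ_ p (sumOver-cong ps)

sumOver-0 : {f : X → ℤ} → ∀ {xs} → All (λ x → f x ≡ 0ℤ) xs → sumOver f xs ≡ 0ℤ
sumOver-0 []       = refl
sumOver-0 (p ∷ ps) = cong₂ _+ℤ_ p (sumOver-0 ps)

All-concatMap : {P : Y → Set} {Q : X → Set} (f : X → List Y) → (∀ {x} → Q x → All P (f x)) →
                ∀ {xs} → All Q xs → All P (concatMap f xs)
All-concatMap f h []       = []
All-concatMap f h (q ∷ qs) = All.++⁺ (h q) (All-concatMap f h qs)

insertions-shape : ∀ n τ → All (λ υ → ∃₂ λ u v → τ ≡ u ++ v × υ ≡ u ++ n ∷ v) (insertions n τ)
insertions-shape n []      = ([] , [] , refl , refl) ∷ []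
insertions-shape n (x ∷ τ) = ([] , x ∷ τ , refl , refl) ∷
  All.map⁺ (All.map (λ (u , v , p , q) → x ∷ u , v , cong (x ∷_) p , cong (x ∷_) q) (insertions-shape n τ))

length-insert : ∀ u v {n : ℕ} → length (u ++ n ∷ v) ≡ suc (length (u ++ v))
length-insert []      v = refl
length-insert (_ ∷ u) v = cong suc (length-insert u v)

Bounded : ℕ → List ℕ → Set
Bounded n τ = length τ ≡ n × All (_< n) τ

Bounded-insert : ∀ {n} u v → Bounded n (u ++ v) → Bounded (suc n) (u ++ n ∷ v)
Bounded-insert u v (e , b) =
  trans (length-insert u v) (cong suc e) ,
  All.++⁺ (All.map m<n⇒m<1+n (All.++⁻ˡ u b)) (n<1+n _ ∷ All.map m<n⇒m<1+n (All.++⁻ʳ u b))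

perms-bounded : ∀ n → All (Bounded n) (perms n)
perms-bounded zero    = (refl , []) ∷ []
perms-bounded (suc n) = All-concatMap (insertions n)
  (λ {τ} b → All.map (λ { (u , v , refl , refl) → Bounded-insert u v b }) (insertions-shape n τ))
  (perms-bounded n)

insertAt : ℕ → ℕ → List ℕ → List ℕ
insertAt p n τ = take p τ ++ n ∷ drop p τ

sum-insertions : ∀ n p τ (G : List ℕ → ℤ) →
                 (∀ u v → τ ≡ u ++ v → length u ≢ p → G (u ++ n ∷ v) ≡ 0ℤ) →
                 p ≤ length τ → sumOver G (insertions n τ) ≡ G (insertAt p n τ)
sum-insertions n zero    []      G h _       = ℤ.+-identityʳ _
sum-insertions n zero    (x ∷ τ) G h _       =
  trans (cong (G (n ∷ x ∷ τ) +ℤ_) (sumOver-0 (All.map⁺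
    (All.map (λ { (u , v , e , refl) → h (x ∷ u) v (cong (x ∷_) e) λ () }) (insertions-shape n τ)))))
  (ℤ.+-identityʳ _)
sum-insertions n (suc p) (x ∷ τ) G h (s≤s l) =
  trans (cong₂ _+ℤ_ (h [] (x ∷ τ) refl λ ()) (trans (cong sumℤ (sym (map-∘ (insertions n τ))))
    (sum-insertions n p τ (G ∘ (x ∷_)) (λ u v e q → h (x ∷ u) v (cong (x ∷_) e) (q ∘ suc-injective)) l)))
  (ℤ.+-identityˡ _)

-- `perms` builds permutations by inserting a new largest entry, so lists are taken apart at their
-- largest entry to match that recursion.
MaxSplit : List ℕ → ℕ → List ℕ → Set
MaxSplit xs m ys = All (_< m) xs × All (_< m) ys

maxSplit : ∀ x ρ → Unique (x ∷ ρ) → ∃₂ λ xs m → ∃ λ ys → x ∷ ρ ≡ xs ++ m ∷ ys × MaxSplit xs m ys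
maxSplit x []      _        = [] , x , [] , refl , [] , []
maxSplit x (y ∷ ρ) (u ∷ us) with maxSplit y ρ us
... | xs , m , ys , e , p , q with <-cmp x m
... | tri< lt _ _   = x ∷ xs , m , ys , cong (x ∷_) e , lt ∷ p , q
... | tri> _ _ gt   = [] , x , _ , refl , [] ,
  subst (All (_< x)) (sym e) (All.++⁺ (All.map (λ l → <-trans l gt) p) (gt ∷ All.map (λ l → <-trans l gt) q))
... | tri≈ _ refl _ = ⊥-elim (All.head (All.++⁻ʳ xs (subst (All (x ≢_)) e u)) refl)

maxSplit-unique : ∀ us {m vs} us′ {m′ vs′} → us ++ m ∷ vs ≡ us′ ++ m′ ∷ vs′ →
                  MaxSplit us m vs → MaxSplit us′ m′ vs′ → us ≡ us′ × m ∷ vs ≡ m′ ∷ vs′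
maxSplit-unique []       []         e    _       _        = refl , e
maxSplit-unique []       (u′ ∷ us′) refl (_ , q) (p′ ∷ _ , _) =
  contradiction p′ (<-asym (All.head (All.++⁻ʳ us′ q)))
maxSplit-unique (u ∷ us) []         refl (p ∷ _ , _) (_ , q′) =
  contradiction p (<-asym (All.head (All.++⁻ʳ us q′)))
maxSplit-unique (u ∷ us) (_ ∷ us′)  e    (_ ∷ p , q) (_ ∷ p′ , q′)
  with refl ← cong (take 1) e
  with refl , e′ ← maxSplit-unique us us′ (cong (drop 1) e) (p , q) (p′ , q′) = refl , e′

<⇒<ᵇ≡ : ∀ {x m} → x < m → (x <ᵇ m) ≡ true × (m <ᵇ x) ≡ false
<⇒<ᵇ≡ {x} {m} lt with x <ᵇ m in e | m <ᵇ x in e′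
... | true  | false = refl , refl
... | true  | true  = contradiction (<ᵇ⇒< m x (subst T (sym e′) _)) (<-asym lt)
... | false | _     = ⊥-elim (subst T e (<⇒<ᵇ lt))

Same-< : ∀ {x y n m} → x < n → y < m → Same x y n m
Same-< p q = let a , b = <⇒<ᵇ≡ p ; c , d = <⇒<ᵇ≡ q in trans a (sym c) , trans b (sym d)

Same-<⁻ : ∀ {x y n m} → Same x y n m → x < n → y < m
Same-<⁻ {y = y} {m = m} (e , _) p = <ᵇ⇒< y m (subst T e (<⇒<ᵇ p))

Same->⁻ : ∀ {x y n m} → Same x y n m → n < x → m < y
Same->⁻ {y = y} {m = m} (_ , e) p = <ᵇ⇒< m y (subst T e (<⇒<ᵇ p))

All-Pointwise : ∀ {R : ℕ → ℕ → Set} {P Q : ℕ → Set} → (∀ {x y} → R x y → P x → Q y) →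
                ∀ {xs ys} → Pointwise R xs ys → All P xs → All Q ys
All-Pointwise f []       []       = []
All-Pointwise f (r ∷ rs) (p ∷ ps) = f r p ∷ All-Pointwise f rs ps

Pointwise-All : ∀ {R : ℕ → ℕ → Set} {P Q : ℕ → Set} → (∀ {x y} → P x → Q y → R x y) →
                ∀ {xs ys} → length xs ≡ length ys → All P xs → All Q ys → Pointwise R xs ys
Pointwise-All f e []       []       = []
Pointwise-All f e (p ∷ ps) (q ∷ qs) = f p q ∷ Pointwise-All f (cong pred e) ps qs

++-injective : ∀ (us : List ℕ) {vs us′ vs′} → length us ≡ length us′ →
               us ++ vs ≡ us′ ++ vs′ → us ≡ us′ × vs ≡ vs′
++-injective []       {us′ = []}      _ e = refl , e
++-injective (u ∷ us) {us′ = _ ∷ us′} l e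
  with refl ← cong (take 1) e
  with refl , e′ ← ++-injective us {us′ = us′} (cong pred l) (cong (drop 1) e) = refl , e′

module _ {us m vs} (M : MaxSplit us m vs) where

  -- An order isomorphism sends the largest entry to the largest entry, whose position is unique;
  -- deleting both leaves an order isomorphism.
  maxSplit-≅ : ∀ u v {n} → MaxSplit u n v → u ++ n ∷ v ≅ us ++ m ∷ vs →
               length u ≡ length us × u ++ v ≅ us ++ vs
  maxSplit-≅ u v (p , q) e with ≅-++⁻ u e
  ... | ws , _ , eq , ews , s ∷ er , c
    with refl , refl ← maxSplit-unique us ws eq M
      ( All-Pointwise (λ { (sm ∷ _) lt → Same-<⁻ sm lt }) c p
      , All-Pointwise (λ sm lt → Same->⁻ sm lt) s q)
    = ≅-length ews , ≅-++⁺ ews er (Pointwise.map (λ { (_ ∷ r) → r }) c)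

  maxSplit-≅⁺ : ∀ u v {n} → MaxSplit u n v → length u ≡ length us → u ++ v ≅ us ++ vs →
                u ++ n ∷ v ≅ us ++ m ∷ vs
  maxSplit-≅⁺ u v (p , q) l e with ≅-++⁻ u e
  ... | ws , xs , eq , ews , er , c
    with refl , refl ← ++-injective us {us′ = ws} (trans (sym l) (≅-length ews)) eq
    = ≅-++⁺ ews (Pointwise-All (λ lt lt′ → let a , b = Same-< lt lt′ in b , a) (≅-length er) q (proj₂ M) ∷ er)
        (cons (Pointwise-All Same-< (≅-length ews) p (proj₁ M)) c)
    where
    cons : ∀ {x y xs ys rs ss} → Pointwise (λ a b → Same a b x y) xs ys →
           Cross xs ys rs ss → Cross xs ys (x ∷ rs) (y ∷ ss)
    cons []       []       = []
    cons (a ∷ as) (b ∷ bs) = (a ∷ b) ∷ cons as bs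

select : Bool → ℤ → ℤ
select b z = if b then z else 0ℤ

-- The summation clause says that `σ` is the only member of `perms n` order-isomorphic to `ρ` and is
-- listed once, in a form that can be used directly inside sums.
Standardised : ℕ → List ℕ → Set
Standardised n ρ = ∃ λ σ → Bounded n σ × σ ≅ ρ ×
  (∀ (f : List ℕ → ℤ) → sumOver (λ τ → select (orderIso τ ρ) (f τ)) (perms n) ≡ f σ)

-- Among the insertions of the new largest entry only those at the position of `m` can match, and
-- then the remaining entries must match `us ++ vs`. So the sum over `perms (suc n)` collapses to
-- one over `perms n`.
standardise-insert : ∀ {n us m vs} → MaxSplit us m vs → length (us ++ vs) ≡ n →
                     Standardised n (us ++ vs) → Standardised (suc n) (us ++ m ∷ vs)
standardise-insert {n} {us} {m} {vs} M l (σ , b , σ≅ , sumσ) =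
  insertAt p n σ
  , Bounded-insert (take p σ) (drop p σ) (subst (Bounded n) (sym (take++drop≡id p σ)) b)
  , insert-≅ b σ≅
  , λ f → let G = λ τ → select (orderIso τ (us ++ m ∷ vs)) (f τ) in begin
    sumOver G (concatMap (insertions n) (perms n))
      ≡⟨ sumOver-concatMap G (insertions n) (perms n) ⟩
    sumOver (sumOver G ∘ insertions n) (perms n)
      ≡⟨ sumOver-cong (All.map (λ {τ} b → trans
           (sum-insertions n p τ G
             (λ { u v refl q → cong (λ c → select c (f (u ++ n ∷ v))) (misplaced u v b q) }) (p≤ b))
           (cong (λ c → select c (f (insertAt p n τ))) (T-injective (remove-≅ b) (insert-orderIso b))))
         (perms-bounded n)) ⟩
    sumOver (λ τ → select (orderIso τ (us ++ vs)) (f (insertAt p n τ))) (perms n)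
      ≡⟨ sumσ (f ∘ insertAt p n) ⟩
    f (insertAt p n σ) ∎
  where
  open ≡-Reasoning
  p = length us
  p≤ : ∀ {τ} → Bounded n τ → p ≤ length τ
  p≤ (refl , _) = ≤-trans (m≤m+n p _) (≤-reflexive (trans (sym (length-++ us)) l))
  split : ∀ {τ} → Bounded n τ → MaxSplit (take p τ) n (drop p τ)
  split (_ , b) = All.take⁺ p b , All.drop⁺ p b
  insert-≅ : ∀ {τ} → Bounded n τ → τ ≅ us ++ vs → insertAt p n τ ≅ us ++ m ∷ vs
  insert-≅ {τ} b e = maxSplit-≅⁺ M (take p τ) (drop p τ) (split b)
    (trans (length-take p τ) (m≤n⇒m⊓n≡m (p≤ b))) (subst (_≅ us ++ vs) (sym (take++drop≡id p τ)) e)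
  insert-orderIso : ∀ {τ} → Bounded n τ → T (orderIso τ (us ++ vs)) →
                    T (orderIso (insertAt p n τ) (us ++ m ∷ vs))
  insert-orderIso {τ} b h = ≅⇒orderIso (insert-≅ b (orderIso⇒≅ τ _ h))
  misplaced : ∀ u v → Bounded n (u ++ v) → length u ≢ p → orderIso (u ++ n ∷ v) (us ++ m ∷ vs) ≡ false
  misplaced u v (_ , b) q with orderIso (u ++ n ∷ v) (us ++ m ∷ vs) in e
  ... | false = refl
  ... | true  = contradiction
    (proj₁ (maxSplit-≅ M u v (All.++⁻ˡ u b , All.++⁻ʳ u b) (orderIso⇒≅ (u ++ n ∷ v) _ (subst T (sym e) _)))) q
  remove-≅ : ∀ {τ} → Bounded n τ → T (orderIso (insertAt p n τ) (us ++ m ∷ vs)) → T (orderIso τ (us ++ vs))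
  remove-≅ {τ} b h = ≅⇒orderIso (subst (_≅ us ++ vs) (take++drop≡id p τ)
    (proj₂ (maxSplit-≅ M (take p τ) (drop p τ) (split b) (orderIso⇒≅ (insertAt p n τ) _ h))))

standardise : ∀ n ρ → length ρ ≡ n → Unique ρ → Standardised n ρ
standardise zero    []      _ _ = [] , (refl , []) , [] , λ f → ℤ.+-identityʳ _
standardise (suc n) (x ∷ ρ) l u with maxSplit x ρ u
... | us , m , vs , e , M =
  let l′ = suc-injective (trans (sym (length-insert us vs)) (trans (cong length (sym e)) l))
  in  subst (Standardised (suc n)) (sym e) (standardise-insert M l′
        (standardise n (us ++ vs) l′ (Unique-⊆ (omit us) (subst Unique e u))))
  where
  omit : ∀ us → us ++ vs ⊆ us ++ m ∷ vs
  omit []       = m ∷ʳ ⊆-refl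
  omit (_ ∷ us) = refl ∷ omit us

-- The Möbius function

permsUpTo : ℕ → List (List ℕ)
permsUpTo m = concatMap perms (map suc (upTo m))

permsUpTo-suc : ∀ m → permsUpTo (suc m) ≡ permsUpTo m ++ perms (suc m)
permsUpTo-suc m = begin
  concatMap perms (map suc (upTo (suc m)))
    ≡⟨ cong (concatMap perms ∘ map suc) (sym (upTo-∷ʳ m)) ⟩
  concatMap perms (map suc (upTo m ++ [ m ]))
    ≡⟨ cong (concatMap perms) (map-++ suc (upTo m) [ m ]) ⟩
  concatMap perms (map suc (upTo m) ++ [ suc m ])
    ≡⟨ concatMap-++ perms (map suc (upTo m)) [ suc m ] ⟩
  permsUpTo m ++ (perms (suc m) ++ [])
    ≡⟨ cong (permsUpTo m ++_) (++-identityʳ _) ⟩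
  permsUpTo m ++ perms (suc m) ∎
  where open ≡-Reasoning

permsUpTo-length : ∀ m → All (λ τ → length τ ≤ m) (permsUpTo m)
permsUpTo-length zero    = []
permsUpTo-length (suc m) = subst (All _) (sym (permsUpTo-suc m))
  (All.++⁺ (All.map m≤n⇒m≤1+n (permsUpTo-length m)) (All.map (≤-reflexive ∘ proj₁) (perms-bounded (suc m))))

sum-if : (p : X → Bool) (f : X → ℤ) → ∀ xs →
         sumℤ (concatMap (λ x → if p x then f x ∷ [] else []) xs) ≡ sumOver (λ x → select (p x) (f x)) xs
sum-if p f []       = refl
sum-if p f (x ∷ xs) with p x
... | true  = cong (f x +ℤ_) (sum-if p f xs)
... | false = trans (sum-if p f xs) (sym (ℤ.+-identityˡ _))

sum-below : ∀ (p : List ℕ → Bool) (f : List ℕ → ℤ) m →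
  sumℤ (concatMap (λ k → concatMap (λ τ → if p τ then f τ ∷ [] else []) (perms k)) (map suc (upTo m)))
  ≡ sumOver (λ τ → select (p τ) (f τ)) (permsUpTo m)
sum-below p f m = go (map suc (upTo m))
  where
  go : ∀ ks → sumℤ (concatMap (λ k → concatMap (λ τ → if p τ then f τ ∷ [] else []) (perms k)) ks)
     ≡ sumOver (λ τ → select (p τ) (f τ)) (concatMap perms ks)
  go []       = refl
  go (k ∷ ks) = trans (sumℤ-++ (concatMap _ (perms k)) _)
    (trans (cong₂ _+ℤ_ (sum-if p f (perms k)) (go ks)) (sym (sumOver-++ _ (perms k) _)))

eqL-length : ∀ xs ys → T (eqL xs ys) → length xs ≡ length ys
eqL-length []       []       _ = refl
eqL-length (x ∷ xs) (y ∷ ys) h = cong suc (eqL-length xs ys (proj₂ (to (T-∧ {x ≡ᵇ y}) h)))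

sumBelow : List ℕ → ℕ → ℤ
sumBelow ρ m = sumOver (λ τ → select (contains τ ρ) (mu1 τ)) (permsUpTo m)

-- Recursive calls go to strictly shorter permutations, so any fuel that is at least the length
-- gives the same value.
mu1F-fuel : ∀ f g π → length π ≤ f → length π ≤ g → mu1F f π ≡ mu1F g π
mu1F-fuel zero    zero    π       _ _ = refl
mu1F-fuel zero    (suc g) []      _ _ = refl
mu1F-fuel (suc f) zero    []      _ _ = refl
mu1F-fuel (suc f) (suc g) []      _ _ = refl
mu1F-fuel (suc f) (suc g) π@(_ ∷ xs) (s≤s lf) (s≤s lg) with eqL π (0 ∷ [])
... | true  = refl
... | false = cong -_ (trans (sum-below (λ τ → contains τ π) (mu1F f) (length xs)) (trans
  (sumOver-cong (All.map (λ {τ} l → cong (select (contains τ π)) (mu1F-fuel f g τ (≤-trans l lf) (≤-trans l lg)))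
    (permsUpTo-length (length xs))))
  (sym (sum-below (λ τ → contains τ π) (mu1F g) (length xs)))))

mu1-unfold : ∀ {n} π → length π ≡ suc (suc n) → mu1 π ≡ - sumBelow π (suc n)
mu1-unfold π@(_ ∷ _ ∷ xs) refl with eqL π (0 ∷ []) in e
... | true  = contradiction (eqL-length π (0 ∷ []) (subst T (sym e) _)) λ ()
... | false = cong -_ (trans (sum-below (λ τ → contains τ π) (mu1F n) n)
  (sumOver-cong (All.map (λ {τ} l → cong (select (contains τ π)) (mu1F-fuel n (length τ) τ l ≤-refl))
    (permsUpTo-length n))))
  where n = suc (length xs)

contains-sameLength : ∀ τ ρ → length τ ≡ length ρ → contains τ ρ ≡ orderIso τ ρ
contains-sameLength τ ρ e = T-injective
  (λ h → let w , p , q = contains⇒≼ τ ρ h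
         in ≅⇒orderIso (subst (τ ≅_) (⊆-length-≡ p (≤-reflexive (trans (sym e) (≅-length q)))) q))
  (λ h → ≼⇒contains (≅⇒≼ (orderIso⇒≅ τ ρ h)))

sumBelow-suc : ∀ ρ m → sumBelow ρ (suc m) ≡
               sumBelow ρ m +ℤ sumOver (λ τ → select (contains τ ρ) (mu1 τ)) (perms (suc m))
sumBelow-suc ρ m = trans (cong (sumOver _) (permsUpTo-suc m)) (sumOver-++ _ (permsUpTo m) _)

-- At length |ρ| only the standardisation `σ` of `ρ` contributes, and the recursion for its Möbius
-- value cancels all shorter permutations; longer ones are not contained in `ρ`.
sumBelow-0 : ∀ {n m} ρ → Unique ρ → length ρ ≡ suc (suc n) → length ρ ≤′ m → sumBelow ρ m ≡ 0ℤ
sumBelow-0 {n} ρ u l ≤′-refl with standardise (length ρ) ρ refl u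
... | σ , (lσ , _) , σ≅ρ , sumσ = subst (λ k → sumBelow ρ k ≡ 0ℤ) (sym l) (begin
  sumBelow ρ (suc (suc n))
    ≡⟨ sumBelow-suc ρ (suc n) ⟩
  sumBelow ρ (suc n) +ℤ sumOver (λ τ → select (contains τ ρ) (mu1 τ)) (perms (suc (suc n)))
    ≡⟨ cong₂ _+ℤ_
         (sumOver-cong (All.universal (λ τ → cong (λ b → select b (mu1 τ)) (contains-congʳ σ≅ρ τ))
                         (permsUpTo (suc n))))
         (trans (sumOver-cong (All.map (λ {τ} b → cong (λ c → select c (mu1 τ))
                   (contains-sameLength τ ρ (trans (proj₁ b) (sym l)))) (perms-bounded (suc (suc n)))))
                (subst (λ k → sumOver (λ τ → select (orderIso τ ρ) (mu1 τ)) (perms k) ≡ mu1 σ) l (sumσ mu1))) ⟩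
  sumBelow σ (suc n) +ℤ mu1 σ
    ≡⟨ cong (sumBelow σ (suc n) +ℤ_) (mu1-unfold σ (trans lσ l)) ⟩
  sumBelow σ (suc n) +ℤ - sumBelow σ (suc n)
    ≡⟨ ℤ.+-inverseʳ (sumBelow σ (suc n)) ⟩
  0ℤ ∎)
  where open ≡-Reasoning
sumBelow-0 {n} {suc m} ρ u l (≤′-step lm) = trans (sumBelow-suc ρ m)
  (cong₂ _+ℤ_ (sumBelow-0 ρ u l lm)
    (sumOver-0 (All.map (λ {τ} b → tooLong τ (proj₁ b)) (perms-bounded (suc m)))))
  where
  tooLong : ∀ τ → length τ ≡ suc m → select (contains τ ρ) (mu1 τ) ≡ 0ℤ
  tooLong τ e with contains τ ρ in c
  ... | false = refl
  ... | true  = contradiction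
    (≤-trans (≤-reflexive (sym e)) (≤-trans (≼-length (contains⇒≼ τ ρ (subst T (sym c) _))) (≤′⇒≤ lm))) 1+n≰n

-- Interval copies

-- Asking every outside entry to lie below or above the whole block replaces the condition on
-- consecutive values: it is invariant under order isomorphism and makes sense in arbitrary
-- sublists.
Apart : List ℕ → ℕ → Set
Apart F z = All (z <_) F ⊎ All (_< z) F

Apart-⊆ : ∀ {F S} → F ⊆ S → ∀ {z} → Apart S z → Apart F z
Apart-⊆ p = Sum.map (All-resp-⊆ p) (All-resp-⊆ p)

Apart-Same : ∀ {F F′ x y} → Pointwise (Same x y) F F′ → Apart F x → Apart F′ y
Apart-Same p = Sum.map (All-Pointwise Same-<⁻ p) (All-Pointwise Same->⁻ p)

record IntervalCopy (f w : List ℕ) : Set where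
  constructor interval
  field
    before block after : List ℕ
    split        : w ≡ before ++ block ++ after
    copy         : f ≅ block
    apart-before : All (Apart block) before
    apart-after  : All (Apart block) after

IntervalCopy-≅ : ∀ {f w w′} → w ≅ w′ → IntervalCopy f w → IntervalCopy f w′
IntervalCopy-≅ e (interval u F v refl c a b)
  with u′ , _ , refl , _ , e₁ , c₁ ← ≅-++⁻ u e
  with F′ , v′ , refl , e₂ , e₃ , c₂ ← ≅-++⁻ F e₁ =
  interval u′ F′ v′ refl (≅-trans c e₂)
    (All-Pointwise Apart-Same (Pointwise.map (proj₁ ∘ Pointwise-++⁻ F (≅-length e₂)) c₁) a)
    (All-Pointwise Apart-Same (Cross-swap (≅-length e₃) c₂) b)

-- An entry apart from `S` is apart from every part of `S`, so an interval of `s` stays an interval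
-- in the longer list.
IntervalCopy-context : ∀ {f s S} x y → s ⊆ S → All (Apart S) x → All (Apart S) y →
                       IntervalCopy f s → IntervalCopy f (x ++ s ++ y)
IntervalCopy-context x y p ax ay (interval u F v refl c a b) =
  interval (x ++ u) F (v ++ y)
    (trans (cong (x ++_) (trans (++-assoc u (F ++ v) y) (cong (u ++_) (++-assoc F v y))))
           (sym (++-assoc x u (F ++ v ++ y))))
    c (All.++⁺ (All.map (Apart-⊆ F⊆S) ax) a) (All.++⁺ b (All.map (Apart-⊆ F⊆S) ay))
  where
  F⊆S = ⊆-trans (⊆-trans (++⁺ʳ v ⊆-refl) (++⁺ˡ u ⊆-refl)) p

apartᵇ : List ℕ → ℕ → Bool
apartᵇ F z = all (z <ᵇ_) F ∨ all (_<ᵇ z) F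

splits : List ℕ → List (List ℕ × List ℕ)
splits []       = ([] , []) ∷ []
splits (x ∷ xs) = ([] , x ∷ xs) ∷ map (λ (u , v) → x ∷ u , v) (splits xs)

startsAt : List ℕ → List ℕ × List ℕ → Bool
startsAt f (u , r) =
  let F = take (length f) r ; v = drop (length f) r in
  orderIso f F ∧ (all (apartᵇ F) u ∧ all (apartᵇ F) v)

-- Decides `IntervalCopy`. It is true for empty `f`, so a certificate with an empty right half
-- reacts to its left half alone.
has : List ℕ → List ℕ → Bool
has f x = any (startsAt f) (splits x)

∈-splits⁻ : ∀ {u r} x → (u , r) ∈ splits x → x ≡ u ++ r
∈-splits⁻ []      (here refl) = refl
∈-splits⁻ (x ∷ xs) (here refl) = refl
∈-splits⁻ (x ∷ xs) (there h) with _ , p , refl ← ∈-map⁻ _ h = cong (x ∷_) (∈-splits⁻ xs p)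

∈-splits⁺ : ∀ u r → (u , r) ∈ splits (u ++ r)
∈-splits⁺ []      []      = here refl
∈-splits⁺ []      (_ ∷ _) = here refl
∈-splits⁺ (x ∷ u) r       = there (∈-map⁺ _ (∈-splits⁺ u r))

apartᵇ⇒Apart : ∀ {F z} → T (apartᵇ F z) → Apart F z
apartᵇ⇒Apart {F} {z} = Sum.map (All.map (<ᵇ⇒< z _) ∘ All.all⁺ _ F) (All.map (<ᵇ⇒< _ z) ∘ All.all⁺ _ F) ∘ to T-∨

Apart⇒apartᵇ : ∀ {F z} → Apart F z → T (apartᵇ F z)
Apart⇒apartᵇ = from T-∨ ∘ Sum.map (All.all⁻ _ ∘ All.map <⇒<ᵇ) (All.all⁻ _ ∘ All.map <⇒<ᵇ)

has⇒IntervalCopy : ∀ f x → T (has f x) → IntervalCopy f x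
has⇒IntervalCopy f x h with find (any⁻ (startsAt f) (splits x) h)
... | (u , r) , p , q with to T-∧ q
... | q₁ , q₂ with to T-∧ q₂
... | q₃ , q₄ = interval u (take (length f) r) (drop (length f) r)
  (trans (∈-splits⁻ x p) (cong (u ++_) (sym (take++drop≡id (length f) r))))
  (orderIso⇒≅ f _ q₁) (All.map apartᵇ⇒Apart (All.all⁺ _ u q₃)) (All.map apartᵇ⇒Apart (All.all⁺ _ _ q₄))

take-drop-++ : ∀ n (xs : List ℕ) {ys} → n ≡ length xs → take n (xs ++ ys) ≡ xs × drop n (xs ++ ys) ≡ ys
take-drop-++ zero    []       e = refl , refl
take-drop-++ (suc n) (x ∷ xs) e = let p , q = take-drop-++ n xs (cong pred e) in cong (x ∷_) p , q

IntervalCopy⇒has : ∀ {f x} → IntervalCopy f x → T (has f x)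
IntervalCopy⇒has {f} (interval u F v refl c a b) =
  any⁺ (startsAt f) (lose (∈-splits⁺ u (F ++ v)) starts)
  where
  starts : T (startsAt f (u , F ++ v))
  starts with p , q ← take-drop-++ (length f) F {v} (≅-length c) rewrite p | q =
    from T-∧ (≅⇒orderIso c , from T-∧
      (All.all⁻ _ (All.map Apart⇒apartᵇ a) , All.all⁻ _ (All.map Apart⇒apartᵇ b)))

-- Disjoint interval copies

record Disjoint (f g w : List ℕ) : Set where
  constructor disjoint
  field
    {x₀ F x₁ G x₂} : List ℕ
    split     : w ≡ x₀ ++ F ++ x₁ ++ G ++ x₂
    copy-F    : f ≅ F
    copy-G    : g ≅ G
    F-apart-l : All (Apart F) x₀
    F-apart-r : All (Apart F) (x₁ ++ G ++ x₂)
    G-apart-l : All (Apart G) (x₀ ++ F ++ x₁)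
    G-apart-r : All (Apart G) x₂

lt gt : List ℕ → List ℕ → Bool
lt xs ys = all (λ x → all (x <ᵇ_) ys) xs
gt xs ys = all (λ x → all (_<ᵇ x) ys) xs

-- Two partially overlapping intervals F = e ++ k and G = k ++ j satisfy e < k < j or e > k > j.
chain : List ℕ × List ℕ → List ℕ × List ℕ → Bool
chain (e@(_ ∷ _) , k@(_ ∷ _)) (k′ , j@(_ ∷ _)) =
  (length k ≡ᵇ length k′) ∧ ((lt e k ∧ lt k′ j) ∨ (gt e k ∧ gt k′ j))
chain _ _ = false

overlaps : List ℕ → List ℕ → Bool
overlaps f g = any (λ p → any (chain p) (splits g)) (splits f)

-- Rules out nesting and partial overlap, so that copies of `f` and `g` in any one list are
-- disjoint. The test is conservative, as `chain` compares the lengths of the common parts but not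
-- their patterns.
separate : List ℕ → List ℕ → Bool
separate f g = not ((has f g ∨ has g f) ∨ (overlaps f g ∨ overlaps g f))

Less Greater : List ℕ → List ℕ → Set
Less    xs ys = All (λ x → All (x <_) ys) xs
Greater xs ys = All (λ x → All (_< x) ys) xs

lt⁺ : ∀ {xs ys} → Less xs ys → T (lt xs ys)
lt⁺ = All.all⁻ _ ∘ All.map (All.all⁻ _ ∘ All.map <⇒<ᵇ)

gt⁺ : ∀ {xs ys} → Greater xs ys → T (gt xs ys)
gt⁺ = All.all⁻ _ ∘ All.map (All.all⁻ _ ∘ All.map <⇒<ᵇ)

Less-Cross : ∀ {us vs rs ss} → Cross us vs rs ss → Less us rs → Less vs ss
Less-Cross = All-Pointwise (All-Pointwise Same-<⁻)

Greater-Cross : ∀ {us vs rs ss} → Cross us vs rs ss → Greater us rs → Greater vs ss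
Greater-Cross = All-Pointwise (All-Pointwise Same->⁻)

chain⁺ : ∀ x {e z k k′ y j} → suc (length k) ≡ length k′ →
         (Less (x ∷ e) (z ∷ k) × Less k′ (y ∷ j)) ⊎ (Greater (x ∷ e) (z ∷ k) × Greater k′ (y ∷ j)) →
         T (chain (x ∷ e , z ∷ k) (k′ , y ∷ j))
chain⁺ x {e} {z} {k} {k′} {y} {j} l h = from T-∧ (≡⇒≡ᵇ (suc (length k)) (length k′) l , from T-∨
  (Sum.map (λ (p , q) → from T-∧ (lt⁺ p , lt⁺ q)) (λ (p , q) → from T-∧ (gt⁺ p , gt⁺ q)) h))

-- If the first entry of `e` lies below the second block, it lies below all of `j`. Being apart from
-- the first block, `j` then lies above it entirely, which in turn forces every entry of `e` below
-- the second block. The other case is the mirror image.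
chain-order : ∀ x e z k y j → All (Apart (z ∷ k ++ y ∷ j)) (x ∷ e) → All (Apart (x ∷ e ++ z ∷ k)) (y ∷ j) →
  (Less (x ∷ e) (z ∷ k) × Less (z ∷ k) (y ∷ j)) ⊎ (Greater (x ∷ e) (z ∷ k) × Greater (z ∷ k) (y ∷ j))
chain-order x e z k y j a@(inj₁ x<G ∷ _) b =
  inj₁ (All.zipWith e<k (a , All.++⁻ˡ (x ∷ e) (All.head F<j)) , All.All-swap (All.map (All.++⁻ʳ (x ∷ e)) F<j))
  where
  F<j : Greater (y ∷ j) (x ∷ e ++ z ∷ k)
  F<j = All.zipWith (λ { (x<y , inj₁ y<F) → contradiction x<y (<-asym (All.head y<F))
                       ; (_   , inj₂ F<y) → F<y })
                     (All.++⁻ʳ (z ∷ k) x<G , b)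
  e<k : ∀ {x} → Apart (z ∷ k ++ y ∷ j) x × x < y → All (x <_) (z ∷ k)
  e<k (inj₁ x<G , _)  = All.++⁻ˡ (z ∷ k) x<G
  e<k (inj₂ G<x , lt) = contradiction lt (<-asym (All.head (All.++⁻ʳ (z ∷ k) G<x)))
chain-order x e z k y j a@(inj₂ G<x ∷ _) b =
  inj₂ (All.zipWith k<e (a , All.++⁻ˡ (x ∷ e) (All.head j<F)) , All.All-swap (All.map (All.++⁻ʳ (x ∷ e)) j<F))
  where
  j<F : Less (y ∷ j) (x ∷ e ++ z ∷ k)
  j<F = All.zipWith (λ { (_   , inj₁ y<F) → y<F
                       ; (y<x , inj₂ F<y) → contradiction y<x (<-asym (All.head F<y)) })
                     (All.++⁻ʳ (z ∷ k) G<x , b)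
  k<e : ∀ {x} → Apart (z ∷ k ++ y ∷ j) x × y < x → All (_< x) (z ∷ k)
  k<e (inj₂ G<x , _)  = All.++⁻ˡ (z ∷ k) G<x
  k<e (inj₁ x<G , lt) = contradiction lt (<-asym (All.head (All.++⁻ʳ (z ∷ k) x<G)))

++-align : ∀ (a : List ℕ) {b} c {d} → a ++ b ≡ c ++ d →
           (∃ λ e → c ≡ a ++ e × b ≡ e ++ d) ⊎ (∃ λ e → a ≡ c ++ e × d ≡ e ++ b)
++-align []      c       refl = inj₁ (c , refl , refl)
++-align (x ∷ a) []      refl = inj₂ (x ∷ a , refl , refl)
++-align (x ∷ a) (_ ∷ c) eq with refl ← cong (take 1) eq with ++-align a c (cong (drop 1) eq)
... | inj₁ (e , p , q) = inj₁ (e , cong (x ∷_) p , q)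
... | inj₂ (e , p , q) = inj₂ (e , cong (x ∷_) p , q)

overlaps⁺ : ∀ {f g} x e z k y j → f ≅ x ∷ e ++ z ∷ k → g ≅ z ∷ k ++ y ∷ j →
            All (Apart (z ∷ k ++ y ∷ j)) (x ∷ e) → All (Apart (x ∷ e ++ z ∷ k)) (y ∷ j) → T (overlaps f g)
overlaps⁺ x e z k y j p q a b
  with x′ ∷ e′ , z′ ∷ k′ , refl , p₁ , p₂ , c ← ≅-++⁻ (x ∷ e) (≅-sym p)
  with k″ , y′ ∷ j′ , refl , q₁ , q₂ , c′ ← ≅-++⁻ (z ∷ k) (≅-sym q) =
  any⁺ _ (lose (∈-splits⁺ (x′ ∷ e′) (z′ ∷ k′)) (any⁺ (chain (x′ ∷ e′ , z′ ∷ k′)) (lose (∈-splits⁺ k″ (y′ ∷ j′))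
    (chain⁺ x′ (trans (sym (≅-length p₂)) (≅-length q₁))
      (Sum.map (λ (l , m) → Less-Cross c l , Less-Cross c′ m) (λ (l , m) → Greater-Cross c l , Greater-Cross c′ m)
        (chain-order x e z k y j a b))))))

T-not : ∀ b → T (not b) → ¬ T b
T-not false _ ()

-- The case where F begins no later than G.
disjoint-ordered : ∀ {f g} → ¬ T (has f g) → ¬ T (has g f) → ¬ T (overlaps f g) →
                   ∀ u F {v} e G {v′} → F ++ v ≡ e ++ G ++ v′ → f ≅ F → g ≅ G →
                   All (Apart F) u → All (Apart F) v → All (Apart G) (u ++ e) → All (Apart G) v′ →
                   Disjoint f g (u ++ F ++ v)
disjoint-ordered {f} {g} ¬fg ¬gf ¬ov u F e G eq p q a b a′ b′ with ++-align F e eq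
-- Here `F` ends no later than `G` begins. Otherwise `k` is the part of `F` from the beginning of
-- `G` on, and `G` either ends inside `F` or reaches its end.
... | inj₁ (k , refl , refl) = disjoint refl p q a b a′ b′
... | inj₂ (k , refl , eq′) with ++-align G k eq′
...   | inj₁ (j , refl , refl) = contradiction
        (IntervalCopy⇒has (IntervalCopy-≅ (≅-sym p) (interval e G j refl q (All.++⁻ʳ u a′) (All.++⁻ˡ j b′)))) ¬gf
...   | inj₂ (j , refl , refl) = partial e k j p q b (All.++⁻ʳ u a′) a a′ b′
  where
  partial : ∀ e k j → f ≅ e ++ k → g ≅ k ++ j → All (Apart (e ++ k)) (j ++ _) → All (Apart (k ++ j)) e →
            All (Apart (e ++ k)) u → All (Apart (k ++ j)) (u ++ e) → All (Apart (k ++ j)) _ →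
            Disjoint f g (u ++ (e ++ k) ++ j ++ _)
  -- With `e` empty, `F` is an initial part of `G`; with `k` empty, the blocks are merely adjacent;
  -- with `j` empty, `G` is a final part of `F`. What remains is a proper overlap.
  partial []      k j p q b _ _ _ _ = contradiction
    (IntervalCopy⇒has (IntervalCopy-≅ (≅-sym q) (interval [] k j refl p [] (All.++⁻ˡ j b)))) ¬fg
  partial (x ∷ e) []      j p q b _ a a′ b′ =
    disjoint {x₁ = []} refl p q a b
      (subst (λ l → All (Apart j) (u ++ l)) (sym (trans (++-identityʳ _) (++-identityʳ (x ∷ e)))) a′) b′
  partial e (z ∷ k) []      p q b a _ _ _ = contradiction
    (IntervalCopy⇒has (IntervalCopy-≅ (≅-sym p)
      (interval e (z ∷ k) [] (cong (e ++_) (sym (++-identityʳ (z ∷ k)))) (subst (g ≅_) (++-identityʳ (z ∷ k)) q)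
        (subst (λ G → All (Apart G) e) (++-identityʳ (z ∷ k)) a) []))) ¬gf
  partial (x ∷ e) (z ∷ k) (y ∷ j) p q b a _ _ _ =
    contradiction (overlaps⁺ x e z k y j p q a (All.++⁻ˡ (y ∷ j) b)) ¬ov

separate⇒Disjoint : ∀ {f g w} → T (separate f g) → IntervalCopy f w → IntervalCopy g w →
                    Disjoint f g w ⊎ Disjoint g f w
separate⇒Disjoint {f} {g} sep (interval u F v refl p a b) (interval u′ G v′ eq q a′ b′)
  with excluded ← T-not ((has f g ∨ has g f) ∨ (overlaps f g ∨ overlaps g f)) sep
  with nested ← excluded ∘ from (T-∨ {has f g ∨ has g f}) ∘ inj₁ ∘ from (T-∨ {has f g})
  with overlapping ← excluded ∘ from (T-∨ {has f g ∨ has g f}) ∘ inj₂ ∘ from (T-∨ {overlaps f g})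
  with ++-align u u′ eq
... | inj₁ (e , refl , eq′) = inj₁ (disjoint-ordered (nested ∘ inj₁) (nested ∘ inj₂)
        (overlapping ∘ inj₁) u F e G eq′ p q a b a′ b′)
... | inj₂ (e , refl , eq′) = inj₂ (subst (Disjoint g f) (sym eq) (disjoint-ordered (nested ∘ inj₂)
        (nested ∘ inj₁) (overlapping ∘ inj₂) u′ G e F eq′ q p a′ b′ a b))

-- Certificates and their verification

Term : Set
Term = (List ℕ × List ℕ) × ℤ

-- A certificate claims that (left , right) is an annihilating pair, with ε given by the terms.
record Certificate : Set where
  constructor cert
  field
    left right : List ℕ
    terms      : List Term

open Certificate

-- What matters about the patterns (a , b) in which an embedding of λ meets the two copies: the terms
-- (t , u) with a ≤ t and b ≤ u, and the certificates whose left or right half occurs as an interval.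
record Item : Set where
  constructor item
  field
    under lefts rights : List Bool

open Item

meets : List Bool → List Bool → Bool
meets (x ∷ xs) (y ∷ ys) = (x ∧ y) ∨ meets xs ys
meets _        _        = false

clash : Item → Item → Bool
clash i j = meets (lefts i) (rights j) ∨ meets (rights i) (lefts j)

below : List Bool → List Bool → Bool
below (x ∷ xs) (y ∷ ys) = (not x ∨ y) ∧ below xs ys
below []       []       = true
below _        _        = false

same : List Bool → List Bool → Bool
same (x ∷ xs) (y ∷ ys) = (x ⇔ᵇ y) ∧ same xs ys
same []       []       = true
same _        _        = false

sameItem : Item → Item → Bool
sameItem i j = same (under i) (under j) ∧ (same (lefts i) (lefts j) ∧ same (rights i) (rights j))

nub : List Item → List Item
nub []       = []
nub (i ∷ is) = insertNew (nub is)
  where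
  insertNew : List Item → List Item
  insertNew js = if any (sameItem i) js then js else i ∷ js

weigh : List Bool → List ℤ → ℤ
weigh (b ∷ bs) (c ∷ cs) = if b then c +ℤ weigh bs cs else weigh bs cs
weigh _        _        = 0ℤ

isOne : ℤ → Bool
isOne (ℤ.+ 1) = true
isOne _       = false

join : List Bool → List Bool → List Bool
join = zipWith _∨_

relevant : Item → List Bool → Item → Bool
relevant i u j = not (clash i j ∨ below (under j) u)

-- Runs through the sets of pairwise compatible items, where u joins the terms reached so far; an item
-- that reaches no new term cannot change the weight and is dropped.  The first argument is fuel.
explore : ℕ → List ℤ → List Item → List Bool → Bool
explore zero    cs is       u = false
explore (suc n) cs []       u = isOne (weigh u cs)
explore (suc n) cs (i ∷ is) u =
  explore n cs is u ∧ explore n cs (filterᵇ (relevant i (join (under i) u)) is) (join (under i) u)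

-- Fixing a first item restricts the search to nonempty sets: the empty set has weight 0, and every
-- λ contained in π has an embedding.
start : ℕ → List ℤ → List Item → Bool
start n cs []       = true
start n cs (i ∷ is) = start n cs is ∧ explore n cs (filterᵇ (relevant i (under i)) is) (under i)

-- Each level of the search removes at least one item, and one more level evaluates the weight when
-- none is left.
startAll : List ℤ → List Item → Bool
startAll cs is = start (suc (length is)) cs is

combine : Item → Item → Item
combine i j = item (zipWith _∧_ (under i) (under j)) (join (lefts i) (lefts j)) (join (rights i) (rights j))

-- A single embedding whose item clashes with itself already exhibits an annihilating pair, so such
-- items are discarded.
combineAll : List Item → List Item → List Item
combineAll is js = filterᵇ (λ i → not (clash i i)) (concatMap (λ i → map (combine i) js) is)

entry : List Certificate → List (List ℕ) → List ℕ → Item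
entry base ts a =
  item (map (contains a) ts) (map (λ c → has (left c) a) base) (map (λ c → has (right c) a) base)

fsts snds : List Term → List (List ℕ)
fsts = map (proj₁ ∘ proj₁)
snds = map (proj₂ ∘ proj₁)

items : List Certificate → List ℕ → List ℕ → List Term → List Item
items base α β ts = combineAll (map (entry base (fsts ts)) (subseqs α)) (map (entry base (snds ts)) (subseqs β))

-- The lower bound makes the Möbius sum below π[t,u] vanish; the upper bound makes π[t,u] shorter
-- than π.
valid : List ℕ → List ℕ → Term → Bool
valid α β ((t , u) , _) =
  contains t α ∧ (contains u β ∧ ((2 ≤ᵇ length t + length u) ∧ (length t + length u <ᵇ length α + length β)))

check : List Certificate → List ℕ → List ℕ → List Term → Bool
check base α β ts =
  (2 ≤ᵇ length α + length β) ∧ (all (valid α β) ts ∧ startAll (map proj₂ ts) (nub (items base α β ts)))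

-- Soundness of the search

_⊑_ : List Bool → List Bool → Set
_⊑_ = Pointwise (λ b c → T b → T c)

below⇒⊑ : ∀ xs ys → T (below xs ys) → xs ⊑ ys
below⇒⊑ []           []       _ = []
below⇒⊑ (true ∷ xs)  (y ∷ ys) h = let p , q = to T-∧ h in (λ _ → p) ∷ below⇒⊑ xs ys q
below⇒⊑ (false ∷ xs) (y ∷ ys) h = (λ ()) ∷ below⇒⊑ xs ys h

⊑-antisym : ∀ {xs ys} → xs ⊑ ys → ys ⊑ xs → xs ≡ ys
⊑-antisym []       []       = refl
⊑-antisym (p ∷ ps) (q ∷ qs) = cong₂ _∷_ (T-injective p q) (⊑-antisym ps qs)

⊑-trans : ∀ {xs ys zs} → xs ⊑ ys → ys ⊑ zs → xs ⊑ zs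
⊑-trans = Pointwise.transitive (λ f g → g ∘ f)

join-upper : ∀ {us vs ws} → us ⊑ ws → vs ⊑ ws → us ⊑ join us vs × vs ⊑ join us vs × join us vs ⊑ ws
join-upper []       []       = [] , [] , []
join-upper (p ∷ ps) (q ∷ qs) = let a , b , c = join-upper ps qs in
  (from T-∨ ∘ inj₁) ∷ a , (λ x → from T-∨ (inj₂ x)) ∷ b , ([ p , q ]′ ∘ to T-∨) ∷ c

same⇒≡ : ∀ xs ys → T (same xs ys) → xs ≡ ys
same⇒≡ []       []       _ = refl
same⇒≡ (x ∷ xs) (y ∷ ys) h = let p , q = to T-∧ h in cong₂ _∷_ (⇔ᵇ⇒≡ x p) (same⇒≡ xs ys q)

sameItem⇒≡ : ∀ i j → T (sameItem i j) → i ≡ j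
sameItem⇒≡ (item a b c) (item a′ b′ c′) h
  with p , h′ ← to (T-∧ {same a a′}) h
  with q , r ← to (T-∧ {same b b′}) h′
  with refl ← same⇒≡ a a′ p | refl ← same⇒≡ b b′ q | refl ← same⇒≡ c c′ r = refl

∈-nub : ∀ {i} is → i ∈ is → i ∈ nub is
∈-nub (i ∷ is) h with any (sameItem i) (nub is) in e | h
... | false | here refl = here refl
... | false | there h′  = there (∈-nub is h′)
... | true  | there h′  = ∈-nub is h′
... | true  | here refl with find (any⁻ (sameItem i) (nub is) (subst T (sym e) _))
...   | j , j∈ , eq = subst (_∈ nub is) (sym (sameItem⇒≡ i j eq)) j∈

T-not⁺ : ∀ b → ¬ T b → T (not b)
T-not⁺ true  h = ⊥-elim (h _)
T-not⁺ false h = tt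

∈-filterᵇ : ∀ {X : Set} (p : X → Bool) {x xs} → x ∈ xs → T (p x) → x ∈ filterᵇ p xs
∈-filterᵇ p {x} h q = ∈-filter⁺ (T? ∘ p) h q

-- Real is the unknown set of items of one λ, and total records which of the terms contain λ.  Membership
-- in Real is not known to be decidable, hence the double negation; equality of weights is decidable.
module Exploration (Real : Item → Set) (total : List Bool) (cs : List ℤ)
  (real-⊑     : ∀ {i} → Real i → under i ⊑ total)
  (compatible : ∀ {i j} → Real i → Real j → ¬ T (clash i j))
  (covered    : ∀ u → (∀ {i} → Real i → under i ⊑ u) → total ⊑ u)
  where

  Conclusion : Set
  Conclusion = ¬ ¬ T (isOne (weigh total cs))

  -- The invariant is that each real item is still listed or reaches nothing outside `u`. When the
  -- list is empty, `covered` therefore gives `total ⊑ u`, and the weight of `u` is that of `total`.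
  explore-sound : ∀ n is u → T (explore n cs is u) → (∀ {i} → Real i → i ∈ is ⊎ under i ⊑ u) →
                  u ⊑ total → Conclusion

  -- Once `i` is known to be real, an item that is filtered out either clashes with `i`, and so is
  -- not real, or reaches nothing outside `u`.
  extend-sound : ∀ n {i} is u → Real i → T (explore n cs (filterᵇ (relevant i u) is) u) →
                 (∀ {j} → Real j → j ∈ i ∷ is ⊎ under j ⊑ u) → under i ⊑ u → u ⊑ total → Conclusion
  extend-sound n {i} is u r h inv i⊑u u⊑ = explore-sound n (filterᵇ (relevant i u) is) u h inv′ u⊑
    where
    inv′ : ∀ {j} → Real j → j ∈ filterᵇ (relevant i u) is ⊎ under j ⊑ u
    inv′ {j} s with inv s
    ... | inj₂ q           = inj₂ q
    ... | inj₁ (here refl) = inj₂ i⊑u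
    ... | inj₁ (there j∈) with below (under j) u in e
    ...   | true  = inj₂ (below⇒⊑ (under j) u (subst T (sym e) _))
    ...   | false = inj₁ (∈-filterᵇ (relevant i u) j∈ (T-not⁺ (clash i j ∨ below (under j) u)
                      ([ compatible r s , subst T e ]′ ∘ to (T-∨ {clash i j}))))

  explore-sound (suc n) [] u h inv u⊑ k =
    k (subst (λ v → T (isOne (weigh v cs))) (⊑-antisym u⊑ (covered u (λ r → [ (λ ()) , (λ q → q) ]′ (inv r)))) h)
  explore-sound (suc n) (i ∷ is) u h inv u⊑ k =
    -- Under the double negation one may distinguish whether `i` is real: if not, the branch without
    -- `i` applies, and otherwise the branch with `i`.
    unreal λ r → let a , b , c = join-upper (real-⊑ r) u⊑ in
      extend-sound n is (join (under i) u) r h₂ (Sum.map₂ (λ q → ⊑-trans q b) ∘ inv) a c k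
    where
    h₁ = proj₁ (to (T-∧ {explore n cs is u}) h)
    h₂ = proj₂ (to (T-∧ {explore n cs is u}) h)
    unreal : ¬ ¬ Real i
    unreal ¬r = explore-sound n is u h₁ (λ s → absent s (inv s)) u⊑ k
      where
      absent : ∀ {j} → Real j → j ∈ i ∷ is ⊎ under j ⊑ u → j ∈ is ⊎ under j ⊑ u
      absent s (inj₁ (here refl)) = contradiction s ¬r
      absent s (inj₁ (there q))   = inj₁ q
      absent s (inj₂ q)           = inj₂ q

  start-sound : ∀ n is → T (start n cs is) → (∀ {i} → Real i → i ∈ is) → ∃ Real → Conclusion
  start-sound n []       h inv (_ , r) k = contradiction (inv r) λ ()
  start-sound n (i ∷ is) h inv r k =
    unreal λ s → extend-sound n is (under i) s h₂ (inj₁ ∘ inv) (Pointwise.refl (λ x → x)) (real-⊑ s) k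
    where
    h₁ = proj₁ (to (T-∧ {start n cs is}) h)
    h₂ = proj₂ (to (T-∧ {start n cs is}) h)
    unreal : ¬ ¬ Real i
    unreal ¬r = start-sound n is h₁ (λ s → absent s (inv s)) r k
      where
      absent : ∀ {j} → Real j → j ∈ i ∷ is → j ∈ is
      absent s (here refl) = contradiction s ¬r
      absent s (there q)   = q

-- Embeddings into a permutation with two disjoint interval copies

⊆-++⁻ : ∀ {w : List ℕ} xs {ys} → w ⊆ xs ++ ys → ∃₂ λ u v → w ≡ u ++ v × u ⊆ xs × v ⊆ ys
⊆-++⁻ []       p = [] , _ , refl , [] , p
⊆-++⁻ (x ∷ xs) (_ ∷ʳ p)  with u , v , refl , q , r ← ⊆-++⁻ xs p = u , v , refl , x ∷ʳ q , r
⊆-++⁻ (x ∷ xs) (refl ∷ p) with u , v , refl , q , r ← ⊆-++⁻ xs p = x ∷ u , v , refl , refl ∷ q , r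

Cross-apart : ∀ {S s r} → s ⊆ S → r ⊆ S → length s ≡ length r →
              ∀ {xs} → All (Apart S) xs → Cross xs xs s r
Cross-apart p q e []            = []
Cross-apart p q e (inj₁ a ∷ as) =
  Pointwise-All Same-< e (All-resp-⊆ p a) (All-resp-⊆ q a) ∷ Cross-apart p q e as
Cross-apart p q e (inj₂ a ∷ as) =
  Pointwise-All (λ l m → let x , y = Same-< l m in y , x) e (All-resp-⊆ p a) (All-resp-⊆ q a)
  ∷ Cross-apart p q e as

-- Entries apart from `S` compare alike with all elements of `S`, so exchanging `s` for `r` within
-- `S` changes no comparison with the rest.
replace : ∀ {S s r} x y → s ⊆ S → r ⊆ S → s ≅ r → All (Apart S) x → All (Apart S) y → x ++ s ++ y ≅ x ++ r ++ y
replace x y p q e ax ay =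
  ≅-++⁺ ≅-refl
    (≅-++⁺ e ≅-refl (Cross-swap (≅-length e) (Cross-apart p q (≅-length e) ay)))
    (cross (Cross-apart p q (≅-length e) ax))
  where
  cross : ∀ {xs s r} → Cross xs xs s r → Cross xs xs (s ++ y) (r ++ y)
  cross []       = []
  cross {x ∷ _} (c ∷ cs) = Pointwise.++⁺ c (Pointwise.refl (λ {z} → Same-refl x z)) ∷ cross cs

++-regroup : ∀ (a b c d : List ℕ) → a ++ b ++ c ++ d ≡ (a ++ b ++ c) ++ d
++-regroup a b c d = trans (cong (a ++_) (sym (++-assoc b c d))) (sym (++-assoc a (b ++ c) d))

module Embedding {α β π : List ℕ} (d : Disjoint α β π) where
  open Disjoint d

  -- This is π[t,u] when `R` and `Q` are sublists of the two blocks that are order-isomorphic to t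
  -- and u.
  fill : List ℕ → List ℕ → List ℕ
  fill R Q = x₀ ++ R ++ x₁ ++ Q ++ x₂

  -- An embedding of `l` into π, cut along the five parts of π. Its traces on the two copies are
  -- recorded up to order isomorphism by `a` and `b`, which can then be chosen from the finitely
  -- many sublists of `α` and `β`.
  record Embeds (l a b : List ℕ) : Set where
    constructor embeds
    field
      {y₀ s y₁ t y₂} : List ℕ
      y₀⊆ : y₀ ⊆ x₀
      s⊆  : s ⊆ F
      y₁⊆ : y₁ ⊆ x₁
      t⊆  : t ⊆ G
      y₂⊆ : y₂ ⊆ x₂
      a≅s : a ≅ s
      b≅t : b ≅ t
      l≅  : l ≅ y₀ ++ s ++ y₁ ++ t ++ y₂

  fill-⊆ : ∀ {R Q} → R ⊆ F → Q ⊆ G → fill R Q ⊆ π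
  fill-⊆ {R} {Q} p q = subst (fill R Q ⊆_) (sym split)
    (++⁺ (⊆-refl {x = x₀}) (++⁺ p (++⁺ (⊆-refl {x = x₁}) (++⁺ q (⊆-refl {x = x₂})))))

  fill-length : ∀ R Q → length (fill R Q) ≡ (length x₀ + length x₁ + length x₂) + (length R + length Q)
  fill-length R Q = trans (length-++ x₀) (trans (cong (length x₀ +_) (trans (length-++ R) (cong (length R +_)
    (trans (length-++ x₁) (cong (length x₁ +_) (length-++ Q))))))
    (rearrange (length x₀) (length R) (length x₁) (length Q) (length x₂)))
    where
    rearrange : ∀ a r b q c → a + (r + (b + (q + c))) ≡ (a + b + c) + (r + q)
    rearrange = solve-∀

  ≼-fill⁻ : ∀ {l R Q t u} → R ⊆ F → Q ⊆ G → t ≅ R → u ≅ Q → l ≼ fill R Q →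
            ∃₂ λ a b → a ⊆ α × b ⊆ β × a ≼ t × b ≼ u × Embeds l a b
  ≼-fill⁻ {l} {R} {Q} R⊆ Q⊆ t≅ u≅ (w , p , e)
    with y₀ , _ , refl , p₀ , q₀ ← ⊆-++⁻ x₀ p
    with s , _ , refl , p₁ , q₁ ← ⊆-++⁻ R q₀
    with y₁ , _ , refl , p₂ , q₂ ← ⊆-++⁻ x₁ q₁
    with t , y₂ , refl , p₃ , q₃ ← ⊆-++⁻ Q q₂
    with a , a⊆ , s≅a ← ⊆-≅ (⊆-trans p₁ R⊆) (≅-sym copy-F)
    with b , b⊆ , t≅b ← ⊆-≅ (⊆-trans p₃ Q⊆) (≅-sym copy-G) =
    a , b , a⊆ , b⊆ ,
    ≼-trans (s , p₁ , ≅-sym s≅a) (≅⇒≼ (≅-sym t≅)) ,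
    ≼-trans (t , p₃ , ≅-sym t≅b) (≅⇒≼ (≅-sym u≅)) ,
    embeds p₀ (⊆-trans p₁ R⊆) p₂ (⊆-trans p₃ Q⊆) q₃ (≅-sym s≅a) (≅-sym t≅b) e

  apart-y₂ : ∀ {x y z} → x ⊆ x₁ → y ⊆ G → z ⊆ x₂ → All (Apart F) (x ++ y ++ z)
  apart-y₂ p q r = All-resp-⊆ (++⁺ p (++⁺ q r)) F-apart-r

  apart-y₀ : ∀ {x y z} → x ⊆ x₀ → y ⊆ F → z ⊆ x₁ → All (Apart G) (x ++ y ++ z)
  apart-y₀ p q r = All-resp-⊆ (++⁺ p (++⁺ q r)) G-apart-l

  -- The traces of the embedding are moved into `R` and `Q`, one block after the other; each move is
  -- an instance of `replace`, since everything else is apart from the block.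
  ≼-fill⁺ : ∀ {l R Q t u a b} → R ⊆ F → Q ⊆ G → t ≅ R → u ≅ Q → a ≼ t → b ≼ u → Embeds l a b → l ≼ fill R Q
  ≼-fill⁺ R⊆ Q⊆ t≅ u≅ a≼ b≼ (embeds {y₀} {s} {y₁} {t} {y₂} p₀ p₁ p₂ p₃ p₄ a≅s b≅t e)
    with r , r⊆ , a≅r ← ≼-trans a≼ (≅⇒≼ t≅)
    with q , q⊆ , b≅q ← ≼-trans b≼ (≅⇒≼ u≅) =
    y₀ ++ r ++ y₁ ++ q ++ y₂ , ++⁺ p₀ (++⁺ r⊆ (++⁺ p₂ (++⁺ q⊆ p₄))) ,
    ≅-trans e (≅-trans
      (replace y₀ _ p₁ (⊆-trans r⊆ R⊆) (≅-trans (≅-sym a≅s) a≅r) (All-resp-⊆ p₀ F-apart-l) (apart-y₂ p₂ p₃ p₄))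
      (subst₂ _≅_ (sym (regroup r y₁ t)) (sym (regroup r y₁ q))
        (replace (y₀ ++ r ++ y₁) y₂ p₃ (⊆-trans q⊆ Q⊆) (≅-trans (≅-sym b≅t) b≅q)
          (apart-y₀ p₀ (⊆-trans r⊆ R⊆) p₂) (All-resp-⊆ p₄ G-apart-r))))
    where
    regroup : ∀ r y₁ t → y₀ ++ r ++ y₁ ++ t ++ y₂ ≡ (y₀ ++ r ++ y₁) ++ t ++ y₂
    regroup r y₁ t = ++-regroup y₀ r y₁ (t ++ y₂)

  -- The rest of the embedding is apart from the block `F`, so an interval of the trace in `F` is an
  -- interval of `l`.
  has-left : ∀ {l a b} f → Embeds l a b → T (has f a) → IntervalCopy f l
  has-left {a = a} f (embeds {y₀} {s} {y₁} {t} {y₂} p₀ p₁ p₂ p₃ p₄ a≅s _ e) h =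
    IntervalCopy-≅ (≅-sym e) (IntervalCopy-context y₀ (y₁ ++ t ++ y₂) p₁ (All-resp-⊆ p₀ F-apart-l)
      (apart-y₂ p₂ p₃ p₄) (IntervalCopy-≅ a≅s (has⇒IntervalCopy f a h)))

  has-right : ∀ {l a b} f → Embeds l a b → T (has f b) → IntervalCopy f l
  has-right {b = b} f (embeds {y₀} {s} {y₁} {t} {y₂} p₀ p₁ p₂ p₃ p₄ _ b≅t e) h =
    IntervalCopy-≅ (≅-sym e) (subst (IntervalCopy f) (sym (++-regroup y₀ s y₁ (t ++ y₂)))
      (IntervalCopy-context (y₀ ++ s ++ y₁) y₂ p₃ (apart-y₀ p₀ p₁ p₂) (All-resp-⊆ p₄ G-apart-r)
        (IntervalCopy-≅ b≅t (has⇒IntervalCopy f b h))))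

Config : Certificate → List ℕ → Set
Config c w = Disjoint (left c) (right c) w ⊎ Disjoint (right c) (left c) w

usable : Certificate → Bool
usable c = null (right c) ∨ separate (left c) (right c)

usable⇒Config : ∀ c {w} → T (usable c) → IntervalCopy (left c) w → IntervalCopy (right c) w → Config c w
-- The empty right half is placed at the very end of the list.
usable⇒Config c@(cert f []      _) h (interval u F v refl p a b) _ =
  inj₁ (disjoint {x₂ = []} (cong (λ v → u ++ F ++ v) (sym (++-identityʳ v))) p [] a
    (subst (All (Apart F)) (sym (++-identityʳ v)) b) (All.universal (λ _ → inj₁ []) _) [])
usable⇒Config c@(cert f (_ ∷ _) _) h p q = separate⇒Disjoint h p q

meets-map : ∀ {X : Set} (f g : X → Bool) xs → T (meets (map f xs) (map g xs)) →
            ∃ λ x → x ∈ xs × T (f x) × T (g x)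
meets-map f g (x ∷ xs) h with to (T-∨ {f x ∧ g x}) h
... | inj₁ p = x , here refl , to T-∧ p
... | inj₂ q = let y , y∈ , r = meets-map f g xs q in y , there y∈ , r

zipWith-map : ∀ {X Y : Set} (_∙_ : Y → Y → Y) (f g : X → Y) xs →
              zipWith _∙_ (map f xs) (map g xs) ≡ map (λ x → f x ∙ g x) xs
zipWith-map _∙_ f g []       = refl
zipWith-map _∙_ f g (x ∷ xs) = cong (_ ∷_) (zipWith-map _∙_ f g xs)

-- The item of a pair of patterns in the form convenient for proofs. The search computes it by
-- combining two entries, so that containments and intervals are evaluated once for each pattern
-- rather than for each pair.
itemOf : List Certificate → List Term → List ℕ → List ℕ → Item
itemOf base ts a b = item
  (map (λ t → contains a (proj₁ (proj₁ t)) ∧ contains b (proj₂ (proj₁ t))) ts)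
  (map (λ c → has (left c) a ∨ has (left c) b) base)
  (map (λ c → has (right c) a ∨ has (right c) b) base)

combine-entries : ∀ base ts a b → combine (entry base (fsts ts) a) (entry base (snds ts) b) ≡ itemOf base ts a b
combine-entries base ts a b
  rewrite sym (map-∘ {g = contains a} {f = proj₁ ∘ proj₁} ts) | sym (map-∘ {g = contains b} {f = proj₂ ∘ proj₁} ts)
        | zipWith-map _∧_ (contains a ∘ proj₁ ∘ proj₁) (contains b ∘ proj₂ ∘ proj₁) ts
        | zipWith-map _∨_ (λ c → has (left c) a) (λ c → has (left c) b) base
        | zipWith-map _∨_ (λ c → has (right c) a) (λ c → has (right c) b) base = refl

∈-items : ∀ base {α β a b} ts → a ⊆ α → b ⊆ β → ¬ T (clash (itemOf base ts a b) (itemOf base ts a b)) →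
          itemOf base ts a b ∈ items base α β ts
∈-items base {α} {β} {a} {b} ts p q h =
  ∈-filterᵇ (λ i → not (clash i i)) (subst (_∈ concatMap (λ i → map (combine i) js) is) (combine-entries base ts a b)
    (∈-concatMap⁺ (λ i → map (combine i) js) (lose (∈-map⁺ (entry base (fsts ts)) (subseqs⁺ p))
      (∈-map⁺ (combine _) (∈-map⁺ (entry base (snds ts)) (subseqs⁺ q))))))
    (T-not⁺ (clash i₀ i₀) h)
  where
  i₀ = itemOf base ts a b
  is = map (entry base (fsts ts)) (subseqs α)
  js = map (entry base (snds ts)) (subseqs β)

-- The induction hypothesis, stated for lists of distinct entries because this property passes to
-- sublists and along order isomorphisms.
Zero : List Certificate → ℕ → Set
Zero base n = ∀ {l} → length l < n → Unique l → ∀ {c} → c ∈ base → Config c l → mu1 l ≡ 0ℤ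

-- The expansion of a permutation

sumOver-+ : ∀ {X : Set} (f g : X → ℤ) xs → sumOver (λ x → f x +ℤ g x) xs ≡ sumOver f xs +ℤ sumOver g xs
sumOver-+ f g []       = refl
sumOver-+ f g (x ∷ xs) = trans (cong ((f x +ℤ g x) +ℤ_) (sumOver-+ f g xs)) (ℤ-medial (f x) (g x) _ _)
  where
  ℤ-medial : ∀ a b c d → (a +ℤ b) +ℤ (c +ℤ d) ≡ (a +ℤ c) +ℤ (b +ℤ d)
  ℤ-medial = ℤSolver.solve-∀

sumOver-* : ∀ {X : Set} c (f : X → ℤ) xs → sumOver (λ x → c *ℤ f x) xs ≡ c *ℤ sumOver f xs
sumOver-* c f []       = sym (ℤ.*-zeroʳ c)
sumOver-* c f (x ∷ xs) = trans (cong (c *ℤ f x +ℤ_) (sumOver-* c f xs)) (sym (ℤ.*-distribˡ-+ c (f x) _))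

weigh-select : ∀ b bs c cs z → weigh (b ∷ bs) (c ∷ cs) *ℤ z ≡ c *ℤ select b z +ℤ weigh bs cs *ℤ z
weigh-select true  bs c cs z = ℤ.*-distribʳ-+ z c _
weigh-select false bs c cs z = sym (trans (cong (_+ℤ weigh bs cs *ℤ z) (ℤ.*-zeroʳ c)) (ℤ.+-identityˡ _))

weigh-none : ∀ bs cs → All (λ b → b ≡ false) bs → weigh bs cs ≡ 0ℤ
weigh-none []       cs       _          = refl
weigh-none (b ∷ bs) []       _          = refl
weigh-none (_ ∷ bs) (c ∷ cs) (refl ∷ h) = weigh-none bs cs h

-- Exchanging the two summations turns the left side into a combination of the Möbius sums below the
-- members of `ρs`, all of which vanish.
weigh-sum : ∀ ρs cs τs → All (λ ρ → sumOver (λ τ → select (contains τ ρ) (mu1 τ)) τs ≡ 0ℤ) ρs →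
            sumOver (λ τ → weigh (map (contains τ) ρs) cs *ℤ mu1 τ) τs ≡ 0ℤ
weigh-sum []       cs       τs _       = sumOver-0 (All.universal (λ τ → ℤ.*-zeroˡ (mu1 τ)) τs)
weigh-sum (_ ∷ _)  []       τs _       = sumOver-0 (All.universal (λ τ → ℤ.*-zeroˡ (mu1 τ)) τs)
weigh-sum (ρ ∷ ρs) (c ∷ cs) τs (h ∷ hs) = begin
  sumOver (λ τ → weigh (map (contains τ) (ρ ∷ ρs)) (c ∷ cs) *ℤ mu1 τ) τs
    ≡⟨ sumOver-cong (All.universal (λ τ → weigh-select (contains τ ρ) (map (contains τ) ρs) c cs (mu1 τ)) τs) ⟩
  sumOver (λ τ → c *ℤ select (contains τ ρ) (mu1 τ) +ℤ weigh (map (contains τ) ρs) cs *ℤ mu1 τ) τs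
    ≡⟨ sumOver-+ _ _ τs ⟩
  sumOver (λ τ → c *ℤ select (contains τ ρ) (mu1 τ)) τs +ℤ
  sumOver (λ τ → weigh (map (contains τ) ρs) cs *ℤ mu1 τ) τs
    ≡⟨ cong₂ _+ℤ_ (trans (sumOver-* c _ τs) (trans (cong (c *ℤ_) h) (ℤ.*-zeroʳ c))) (weigh-sum ρs cs τs hs) ⟩
  0ℤ ∎
  where open ≡-Reasoning

isOne⇒≡ : ∀ {z} → T (isOne z) → z ≡ 1ℤ
isOne⇒≡ {ℤ.+ 1} _ = refl

2≤⇒suc-suc : ∀ {n} → 2 ≤ n → ∃ λ m → n ≡ suc (suc m)
2≤⇒suc-suc (s≤s (s≤s _)) = _ , refl

sumBelow-vanishes : ∀ ρ m → Unique ρ → 2 ≤ length ρ → length ρ ≤ m → sumBelow ρ m ≡ 0ℤ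
sumBelow-vanishes ρ m u h l = sumBelow-0 ρ u (proj₂ (2≤⇒suc-suc h)) (≤⇒≤′ l)

module Step (base : List Certificate) (ok : T (all usable base)) {α β π : List ℕ} (ts : List Term)
  (d : Disjoint α β π) (π-unique : Unique π) (zero-below : Zero base (length π))
  (2≤ : 2 ≤ length α + length β) (ts-valid : All (T ∘ valid α β) ts)
  (checked : T (startAll (map proj₂ ts) (nub (items base α β ts))))
  where

  open Disjoint d
  open Embedding d

  record Realisation (t : Term) : Set where
    constructor realisation
    field
      {R Q} : List ℕ
      R⊆    : R ⊆ F
      Q⊆    : Q ⊆ G
      t≅R   : proj₁ (proj₁ t) ≅ R
      t≅Q   : proj₂ (proj₁ t) ≅ Q
      long  : 2 ≤ length R + length Q
      short : length R + length Q < length α + length β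
    filled : List ℕ
    filled = fill R Q
  open Realisation

  realise : ∀ {t} → T (valid α β t) → Realisation t
  realise {(t , u) , _} h
    with p , h₁ ← to (T-∧ {contains t α}) h
    with q , h₂ ← to (T-∧ {contains u β}) h₁
    with l , s ← to (T-∧ {2 ≤ᵇ length t + length u}) h₂
    with R , R⊆ , e ← ≼-trans (contains⇒≼ t α p) (≅⇒≼ copy-F)
    with Q , Q⊆ , f ← ≼-trans (contains⇒≼ u β q) (≅⇒≼ copy-G)
    with le ← cong₂ _+_ (≅-length e) (≅-length f) =
    realisation R⊆ Q⊆ e f (≤-trans (≤ᵇ⇒≤ 2 _ l) (≤-reflexive le))
      (≤-trans (≤-reflexive (cong suc (sym le))) (<ᵇ⇒< _ _ s))

  fills : ∀ {ts} → All Realisation ts → List (List ℕ)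
  fills = All.reduce filled

  total : ∀ {ts} → List ℕ → All Realisation ts → List Bool
  total l rs = map (contains l) (fills rs)

  realised : All Realisation ts
  realised = All.map realise ts-valid

  filled-⊆ : ∀ {t} (r : Realisation t) → filled r ⊆ π
  filled-⊆ r = fill-⊆ (R⊆ r) (Q⊆ r)

  rest : ℕ
  rest = length x₀ + length x₁ + length x₂

  π-length : length π ≡ rest + (length α + length β)
  π-length = trans (cong length split) (trans (fill-length F G)
    (cong (rest +_) (sym (cong₂ _+_ (≅-length copy-F) (≅-length copy-G)))))

  2≤π : 2 ≤ length π
  2≤π = ≤-trans 2≤ (≤-trans (m≤n+m _ rest) (≤-reflexive (sym π-length)))

  filled-< : ∀ {t} (r : Realisation t) → length (filled r) < length π
  filled-< r = ≤-trans (≤-reflexive (cong suc (fill-length (R r) (Q r))))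
    (≤-trans (+-monoʳ-< rest (short r)) (≤-reflexive (sym π-length)))

  2≤filled : ∀ {t} (r : Realisation t) → 2 ≤ length (filled r)
  2≤filled r = ≤-trans (long r) (≤-trans (m≤n+m _ rest) (≤-reflexive (sym (fill-length (R r) (Q r)))))

  module Expansion {l} (l< : length l < length π) (l≼ : l ≼ π) (mu≢0 : mu1 l ≢ 0ℤ) where

    l-unique : Unique l
    l-unique = let w , p , e = l≼ in Unique-≅ e (Unique-⊆ p π-unique)

    data Real : Item → Set where
      real : ∀ {a b} → a ⊆ α → b ⊆ β → Embeds l a b → Real (itemOf base ts a b)

    occurs : ∀ {a b} f → Embeds l a b → T (has f a ∨ has f b) → IntervalCopy f l
    occurs {a} f e = [ has-left f e , has-right f e ]′ ∘ to (T-∨ {has f a})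

    no-config : ∀ {c} → c ∈ base → ¬ (IntervalCopy (left c) l × IntervalCopy (right c) l)
    no-config {c} c∈ (p , q) = mu≢0 (zero-below l< l-unique c∈
      (usable⇒Config c (All.lookup (All.all⁺ usable base ok) c∈) p q))

    -- The two halves of a pair may come from different embeddings: both are intervals of the same
    -- `l`, where they would form a configuration excluded by `no-config`.
    compatible : ∀ {i j} → Real i → Real j → ¬ T (clash i j)
    compatible {i} {j} (real _ _ e) (real _ _ e′) h with to (T-∨ {meets (lefts i) (rights j)}) h
    ... | inj₁ m = let c , c∈ , p , q = meets-map _ _ base m in
      no-config c∈ (occurs (left c) e p , occurs (right c) e′ q)
    ... | inj₂ m = let c , c∈ , p , q = meets-map _ _ base m in
      no-config c∈ (occurs (left c) e′ q , occurs (right c) e p)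

    real-∈ : ∀ {i} → Real i → i ∈ nub (items base α β ts)
    real-∈ r@(real p q e) = ∈-nub _ (∈-items base ts p q (compatible r r))

    real-⊑ : ∀ {i} → Real i → under i ⊑ total l realised
    real-⊑ (real {a} {b} _ _ e) = go realised
      where
      go : ∀ {ts} (rs : All Realisation ts) →
           map (λ t → contains a (proj₁ (proj₁ t)) ∧ contains b (proj₂ (proj₁ t))) ts ⊑ total l rs
      go []                               = []
      go {((t , u) , _) ∷ _} (r ∷ rs) =
        (λ h → let p , q = to (T-∧ {contains a t}) h in
          ≼⇒contains (≼-fill⁺ (R⊆ r) (Q⊆ r) (t≅R r) (t≅Q r) (contains⇒≼ a t p) (contains⇒≼ b u q) e)) ∷ go rs

    covered : ∀ u → (∀ {i} → Real i → under i ⊑ u) → total l realised ⊑ u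
    covered u h = go realised u (λ p q e → h (real p q e))
      where
      go : ∀ {ts} (rs : All Realisation ts) u →
           (∀ {a b} → a ⊆ α → b ⊆ β → Embeds l a b →
             map (λ t → contains a (proj₁ (proj₁ t)) ∧ contains b (proj₂ (proj₁ t))) ts ⊑ u) → total l rs ⊑ u
      -- Any embedding of `l` into π will do here: it shows that `u` has no entries left.
      go [] u h with ≼-fill⁻ ⊆-refl ⊆-refl copy-F copy-G (subst (l ≼_) split l≼)
      ... | a , b , p , q , _ , _ , e = h p q e
      go {((t , u) , _) ∷ _} (r ∷ rs) (v ∷ vs) h =
        (λ c → let a , b , p , q , a≼ , b≼ , e = ≼-fill⁻ (R⊆ r) (Q⊆ r) (t≅R r) (t≅Q r) (contains⇒≼ l _ c) in
          Pointwise.head (h p q e) (from (T-∧ {contains a t}) (≼⇒contains a≼ , ≼⇒contains b≼)))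
        ∷ go rs vs (λ p q e → Pointwise.tail (h p q e))
      go (r ∷ rs) [] h with ≼-fill⁻ ⊆-refl ⊆-refl copy-F copy-G (subst (l ≼_) split l≼)
      ... | a , b , p , q , _ , _ , e with () ← h p q e

    someReal : ∃ Real
    someReal with ≼-fill⁻ ⊆-refl ⊆-refl copy-F copy-G (subst (l ≼_) split l≼)
    ... | a , b , p , q , _ , _ , e = _ , real p q e

    weigh-total : weigh (total l realised) (map proj₂ ts) ≡ 1ℤ
    weigh-total = decidable-stable (_ ℤ.≟ 1ℤ) λ k →
      Exploration.start-sound Real (total l realised) (map proj₂ ts) real-⊑ compatible covered
        _ _ checked real-∈ someReal (k ∘ isOne⇒≡)

  weight : List ℕ → ℤ
  weight l = weigh (total l realised) (map proj₂ ts)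

  -- If `l` is not contained in π, it is contained in no reduced list, as these are sublists of π,
  -- and the weight is 0. If its Möbius value is 0, both sides vanish. Otherwise the checked
  -- identity gives weight 1.
  expand : ∀ l → length l < length π → select (contains l π) (mu1 l) ≡ weight l *ℤ mu1 l
  expand l l< with contains l π in e
  ... | false = sym (trans
    (cong (_*ℤ mu1 l) (weigh-none (total l realised) (map proj₂ ts) (none realised))) (ℤ.*-zeroˡ (mu1 l)))
    where
    none : ∀ {ts} (rs : All Realisation ts) → All (λ b → b ≡ false) (total l rs)
    none []       = []
    none (r ∷ rs) = T-injective (λ h → subst T e (≼⇒contains (≼-⊆ (contains⇒≼ l _ h) (filled-⊆ r)))) (λ ())
                    ∷ none rs
  ... | true with mu1 l ℤ.≟ 0ℤ
  ...   | yes z = trans z (sym (trans (cong (weight l *ℤ_) z) (ℤ.*-zeroʳ (weight l))))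
  ...   | no nz = sym (trans (cong (_*ℤ mu1 l)
    (Expansion.weigh-total l< (contains⇒≼ l π (subst T (sym e) _)) nz)) (ℤ.*-identityˡ (mu1 l)))

  mu1-zero : mu1 π ≡ 0ℤ
  mu1-zero with m , e ← 2≤⇒suc-suc 2≤π = trans (mu1-unfold π e) (cong -_ (trans
    (sumOver-cong (All.map (λ {l} h → expand l (≤-trans (s≤s h) (≤-reflexive (sym e))))
      (permsUpTo-length (suc m))))
    (weigh-sum (fills realised) (map proj₂ ts) (permsUpTo (suc m)) (vanish realised))))
    where
    vanish : ∀ {ts} (rs : All Realisation ts) → All (λ ρ → sumBelow ρ (suc m) ≡ 0ℤ) (fills rs)
    vanish []       = []
    vanish (r ∷ rs) = sumBelow-vanishes (filled r) (suc m) (Unique-⊆ (filled-⊆ r) π-unique) (2≤filled r)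
      (≤-pred (≤-trans (filled-< r) (≤-reflexive e))) ∷ vanish rs

-- The induction

swapTerm : Term → Term
swapTerm ((t , u) , c) = (u , t) , c

-- Disjoint α β requires α to occur to the left of β.
checkBoth : List Certificate → Certificate → Bool
checkBoth base c =
  check base (left c) (right c) (terms c) ∧ check base (right c) (left c) (map swapTerm (terms c))

IsPerm⇒Unique : ∀ {π} → IsPerm π → Unique π
IsPerm⇒Unique p = ↭ₛ.Unique-resp-↭ (setoid ℕ) (↭.↭⇒↭ₛ (↭.↭-sym p)) (Unique.upTo⁺ _)

InRange : ℕ → ℕ → ℕ → Set
InRange a k x = a ≤ x × x < a + k

-- Pigeonhole principle: deleting the largest entry leaves distinct entries in a range shorter by
-- one.
range-length : ∀ k a xs → Unique xs → All (InRange a k) xs → length xs ≤ k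
range-length k       a []       _ _ = z≤n
range-length zero    a (x ∷ xs) _ ((l , m) ∷ _) =
  contradiction l (<⇒≱ (<-≤-trans m (≤-reflexive (+-identityʳ a))))
range-length (suc k) a (x ∷ xs) u b with maxSplit x xs u
... | us , m , vs , e , p , q = subst (λ l → length l ≤ suc k) (sym e)
  (≤-trans (≤-reflexive (length-insert us vs)) (s≤s (range-length k a (us ++ vs)
    (Unique-⊆ (++⁺ (⊆-refl {x = us}) (m ∷ʳ ⊆-refl)) (subst Unique e u))
    (All.++⁺ (All.zipWith shrink (p , All.++⁻ˡ us b′)) (All.zipWith shrink (q , All.tail (All.++⁻ʳ us b′)))))))
  where
  b′ = subst (All (InRange a (suc k))) e b
  m≤ : m ≤ a + k
  m≤ = ≤-pred (≤-trans (proj₂ (All.head (All.++⁻ʳ us b′))) (≤-reflexive (+-suc a k)))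
  shrink : ∀ {x} → x < m × InRange a (suc k) x → InRange a k x
  shrink (x<m , a≤x , _) = a≤x , <-≤-trans x<m m≤

outside-apart : ∀ k a F z → All (InRange a k) F → ¬ InRange a k z → Apart F z
outside-apart k a F z b h with z <? a | z <? a + k
... | yes z<a | _        = inj₁ (All.map (λ (a≤x , _) → <-≤-trans z<a a≤x) b)
... | no  z≮a | yes z<ak = contradiction (≮⇒≥ z≮a , z<ak) h
... | no  _   | no  z≮ak = inj₂ (All.map (λ (_ , x<) → <-≤-trans x< (≮⇒≥ z≮ak)) b)

-- An outside entry with a value in the range of the block would give one more distinct value than
-- the range has room for. So all outside entries lie below or above the range.
HasIntervalCopy⇒IntervalCopy : ∀ {φ π} → Unique π → HasIntervalCopy φ π → IntervalCopy φ π
HasIntervalCopy⇒IntervalCopy {φ} {π} u (i , l , (a , b) , iso) = interval us F vs π≡ (orderIso⇒≅ φ F iso)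
  (All.tabulate λ {z} z∈ → outside-apart n a F z b λ r →
    tooMany (z ∷ F) refl (r ∷ b) (Unique-⊆ (++⁺ (from∈ z∈) (++⁺ʳ vs ⊆-refl)) u′))
  (All.tabulate λ {z} z∈ → outside-apart n a F z b λ r →
    tooMany (F ++ z ∷ []) (trans (length-++ F) (trans (+-suc _ 0) (cong suc (+-identityʳ _))))
      (All.++⁺ b (r ∷ [])) (Unique-⊆ (++⁺ˡ us (++⁺ (⊆-refl {x = F}) (from∈ z∈))) u′))
  where
  n  = length φ
  us = take i π
  F  = take n (drop i π)
  vs = drop n (drop i π)
  π≡ : π ≡ us ++ F ++ vs
  π≡ = sym (trans (cong (us ++_) (take++drop≡id n (drop i π))) (take++drop≡id i π))
  u′ = subst Unique π≡ u
  tooMany : ∀ G → length G ≡ suc (length F) → All (InRange a n) G → ¬ Unique G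
  tooMany G e r v = <⇒≱ (n<1+n n)
    (≤-trans (≤-reflexive (trans (cong suc (sym l)) (sym e))) (range-length n a G v r))

module Induction (base : List Certificate) (ok : all usable base ≡ true)
  (checked : all (checkBoth base) base ≡ true) where

  config-zero : ∀ {α β} ts → T (check base α β ts) → ∀ {l} → Unique l → Zero base (length l) →
                Disjoint α β l → mu1 l ≡ 0ℤ
  config-zero {α} {β} ts h u z d
    with p , h′ ← to (T-∧ {2 ≤ᵇ length α + length β}) h
    with q , r ← to (T-∧ {all (valid α β) ts}) h′ =
    Step.mu1-zero base (from T-≡ ok) ts d u z (≤ᵇ⇒≤ 2 _ p) (All.all⁺ _ ts q) r

  zero-all : ∀ n → Zero base n
  zero-all (suc n) {l} (s≤s l≤n) u {c} c∈ =
    [ config-zero (terms c) h₁ u below-l , config-zero (map swapTerm (terms c)) h₂ u below-l ]′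
    where
    below-l : Zero base (length l)
    below-l k<l = zero-all n (<-≤-trans k<l l≤n)
    both = to (T-∧ {check base (left c) (right c) (terms c)})
      (All.lookup (All.all⁺ (checkBoth base) base (from T-≡ checked)) c∈)
    h₁ = proj₁ both
    h₂ = proj₂ both

  annihilator : ∀ {φ ts} → cert φ [] ts ∈ base → Annihilator φ
  annihilator {φ} {ts} c∈ π perm copy =
    zero-all (suc (length π)) (n<1+n _) u c∈
      (usable⇒Config (cert φ [] ts) tt (HasIntervalCopy⇒IntervalCopy u copy)
        -- The right half is empty, and the empty block at the end of π is a copy of it.
        (interval π [] [] (sym (++-identityʳ π)) [] (All.universal (λ _ → inj₁ []) π) []))
    where
    u = IsPerm⇒Unique perm

-- Decimal digits, so that 0 stands for the empty list.
digits : ℕ → List ℕ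
digits n = go n n []
  where
  go : ℕ → ℕ → List ℕ → List ℕ
  go zero    _ acc = acc
  go (suc k) m acc = if m ≡ᵇ 0 then acc else go k (m / 10) (m % 10 ∷ acc)

_⊞_ _⊟_ : ℕ → ℕ → Term
t ⊞ u = (digits t , digits u) , 1ℤ
t ⊟ u = (digits t , digits u) , - 1ℤ

infix 6 _⊞_ _⊟_

-- The signs solve the linear system expressing the identity for ε on all sets of patterns to be considered.
base : List Certificate
base =
  cert (digits 215463) []
    (21546 ⊞ 0 ∷ 25463 ⊞ 0 ∷ 2546 ⊟ 0 ∷ []) ∷
  cert (digits 236145) []
    (26145 ⊞ 0 ∷ 23614 ⊞ 0 ∷ 23145 ⊞ 0 ∷ 23645 ⊞ 0 ∷ 2614 ⊟ 0 ∷ 2314 ⊟ 0 ∷ 2645 ⊟ 0 ∷ []) ∷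
  cert (digits 214653) []
    (21465 ⊞ 0 ∷ 24653 ⊞ 0 ∷ 2653 ⊟ 0 ∷ []) ∷
  -- The pairs from here on are auxiliary: through the induction hypothesis they restrict the
  -- embeddings that the identities have to account for.
  cert (digits 12) (digits 21)
    (12 ⊞ 2 ∷ 1 ⊞ 21 ∷ 1 ⊟ 2 ∷ []) ∷
  -- Every proper pattern of 123 is contained in 12, and an embedding meeting the copy in all of 123
  -- gives λ such an interval; hence a single term suffices.
  cert (digits 123) []
    (12 ⊞ 0 ∷ []) ∷
  cert (digits 321) []
    (32 ⊞ 0 ∷ []) ∷
  cert (digits 132) (digits 3241)
    (32 ⊞ 3241 ∷ 132 ⊞ 324 ∷ 13 ⊞ 3241 ∷ 32 ⊟ 324 ∷ 13 ⊟ 324 ∷ 1 ⊟ 3241 ∷ 1 ⊞ 324 ∷ []) ∷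
  cert (digits 2143) (digits 3241)
    (2143 ⊞ 324 ∷ 214 ⊞ 3241 ∷ 214 ⊟ 324 ∷ []) ∷
  cert (digits 213) (digits 2431)
    (213 ⊞ 243 ∷ 21 ⊞ 2431 ∷ 23 ⊞ 2431 ∷ 21 ⊟ 243 ∷ 23 ⊟ 243 ∷ 2 ⊟ 2431 ∷ 2 ⊞ 243 ∷ []) ∷
  cert (digits 2143) (digits 2431)
    (2143 ⊞ 243 ∷ 243 ⊞ 2431 ∷ 243 ⊟ 243 ∷ []) ∷
  cert (digits 2314) (digits 312)
    (2314 ⊞ 31 ∷ 2314 ⊞ 12 ∷ 231 ⊞ 312 ∷ 2314 ⊟ 3 ∷ 231 ⊟ 31 ∷ 231 ⊟ 12 ∷ 231 ⊞ 3 ∷ []) ∷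
  cert (digits 231) (digits 1423)
    (231 ⊞ 423 ∷ 21 ⊞ 1423 ∷ 23 ⊞ 1423 ∷ 21 ⊟ 423 ∷ 23 ⊟ 423 ∷ 2 ⊟ 1423 ∷ 2 ⊞ 423 ∷ []) ∷
  cert (digits 2413) (digits 1423)
    (413 ⊞ 1423 ∷ 2413 ⊞ 423 ∷ 2413 ⊞ 142 ∷ 2413 ⊟ 123 ∷ 413 ⊟ 423 ∷ 413 ⊟ 142 ∷ 413 ⊞ 123 ∷
     2413 ⊟ 42 ∷ 413 ⊞ 42 ∷ 2413 ⊞ 1 ∷ 413 ⊟ 1 ∷ []) ∷
  cert (digits 2413) (digits 2314)
    (2413 ⊞ 231 ∷ 2413 ⊞ 214 ∷ 2413 ⊟ 234 ∷ 241 ⊞ 2314 ∷ 413 ⊟ 214 ∷ 413 ⊞ 234 ∷ 2413 ⊟ 21 ∷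
     241 ⊟ 231 ∷ 413 ⊞ 21 ∷ 2413 ⊞ 2 ∷ 413 ⊟ 2 ∷ []) ∷
  cert (digits 25134) (digits 1423)
    (5134 ⊟ 1423 ∷ 25134 ⊞ 423 ∷ 2513 ⊞ 1423 ∷ 2534 ⊞ 1423 ∷ 5134 ⊞ 423 ∷ 2513 ⊟ 423 ∷
     251 ⊞ 1423 ∷ 2534 ⊟ 423 ∷ 253 ⊟ 1423 ∷ 251 ⊟ 423 ∷ 253 ⊞ 423 ∷ []) ∷
  cert (digits 25134) (digits 2314)
    (25134 ⊞ 231 ∷ 2513 ⊞ 2314 ∷ 2513 ⊟ 231 ∷ []) ∷
  cert (digits 23514) (digits 1423)
    (2514 ⊞ 1423 ∷ 23514 ⊞ 423 ∷ 2514 ⊟ 423 ∷ []) ∷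
  cert (digits 23514) (digits 2314)
    (2514 ⊞ 2314 ∷ 23514 ⊞ 231 ∷ 2351 ⊟ 2314 ∷ 2314 ⊞ 2314 ∷ 514 ⊞ 2314 ∷ 2514 ⊟ 231 ∷
     2351 ⊞ 231 ∷ 2314 ⊟ 231 ∷ 214 ⊟ 2314 ∷ 514 ⊟ 231 ∷ 214 ⊞ 231 ∷ []) ∷
  cert (digits 25134) (digits 23514)
    (25134 ⊞ 2514 ∷ 2513 ⊞ 23514 ∷ 2513 ⊟ 2514 ∷ []) ∷
  []

base-usable : all usable base ≡ true
base-usable = refl

-- Holds by evaluation: the type checker runs the search for every certificate, with its halves in
-- both orders.
base-checked : all (checkBoth base) base ≡ true
base-checked = refl

theorem6p5 : Annihilator (2 ∷ 1 ∷ 5 ∷ 4 ∷ 6 ∷ 3 ∷ [])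
    × Annihilator (2 ∷ 3 ∷ 6 ∷ 1 ∷ 4 ∷ 5 ∷ [])
    × Annihilator (2 ∷ 1 ∷ 4 ∷ 6 ∷ 5 ∷ 3 ∷ [])
theorem6p5 =
  annihilator (here refl) , annihilator (there (here refl)) , annihilator (there (there (here refl)))
  where open Induction base base-usable base-checked
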